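{- For every positive integer $n$, $\overline{\mathrm{spt}}(7n)\equiv\overline{\mathrm{spt}}(n/7)\pmod 4$ and $\overline{\mathrm{spt}}_\omega(7n)\equiv\overline{\mathrm{spt}}_\omega(n/7)\pmod 4$, with the convention that $\overline{\mathrm{spt}}(x)=\overline{\mathrm{spt}}_\omega(x)=0$ if $x$ is not a positive integer.
   Context: With $(a;q)_n=\prod_{k=0}^{n-1}(1-aq^k)$ and $(a;q)_\infty=\prod_{k\ge0}(1-aq^k)$: $\sum_{n\ge1}\overline{\mathrm{spt}}(n)q^n=\sum_{n\ge1}\frac{q^n(-q^{n+1};q)_\infty}{(1-q^n)^2(q^{n+1};q)_\infty}$, and $\sum_{n\ge1}\overline{\mathrm{spt}}_{\omega}(n)q^n=\sum_{n\ge1}\frac{q^{n}(-q^{n+1};q)_{n}(-q^{2n+2};q^2)_{\infty}}{(1-q^n)^2(q^{n+1};q)_n(q^{2n+2};q^2)_{\infty}}$. -}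

module Defs where

open import Data.Nat using (ℕ; zero; suc; _+_; _*_; _∸_; _≤?_; _≟_)
open import Data.Nat.Divisibility using (_∣?_)
open import Data.Nat.DivMod using (_/_)
open import Data.List using (List; []; _∷_; map; upTo; foldr)
open import Data.Bool using (if_then_else_)
open import Relation.Nullary using (does)

-- Formal power series in q with natural-number coefficients,
-- represented by their coefficient function: f N = [q^N] f.
Series : Set
Series = ℕ → ℕ

Σℕ : List ℕ → ℕ
Σℕ = foldr _+_ 0

one : Series
one N = if does (N ≟ 0) then 1 else 0

_⊗_ : Series → Series → Series
(f ⊗ g) N = Σℕ (map (λ k → f k * g (N ∸ k)) (upTo (suc N)))

infixl 7 _⊗_

shift : ℕ → Series → Series
shift n f N = if does (n ≤? N) then f (N ∸ n) else 0

onePlus : ℕ → Series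
onePlus k N = one N + (if does (N ≟ k) then 1 else 0)

-- the series 1/(1 - q^k) = Σ_{j≥0} q^{kj}   (used only for k ≥ 1)
geom : ℕ → Series
geom k N = if does (k ∣? N) then 1 else 0

prodAP : (ℕ → Series) → ℕ → ℕ → ℕ → Series
prodAP F a d zero = one
prodAP F a d (suc c) = F a ⊗ prodAP F (a + d) d c

-- The generating function
--   Σ_{n≥1} q^n (-q^{n+1};q)_∞ / ((1-q^n)^2 (q^{n+1};q)_∞).
-- For the coefficient of q^N only the summands n ≤ N contribute, and in the
-- infinite products only the factors with exponent ≤ N matter (every other
-- factor is ≡ 1 mod q^{N+1}); we keep N factors, which suffices.
sptbarTerm : ℕ → ℕ → ℕ
sptbarTerm N n =
  shift n (geom n ⊗ geom n
           ⊗ prodAP onePlus (suc n) 1 N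
           ⊗ prodAP geom (suc n) 1 N) N

sptbar : ℕ → ℕ
sptbar N = Σℕ (map (λ i → sptbarTerm N (suc i)) (upTo N))

-- The generating function
--   Σ_{n≥1} q^n (-q^{n+1};q)_n (-q^{2n+2};q^2)_∞
--          / ((1-q^n)^2 (q^{n+1};q)_n (q^{2n+2};q^2)_∞).
sptbarωTerm : ℕ → ℕ → ℕ
sptbarωTerm N n =
  shift n (geom n ⊗ geom n
           ⊗ prodAP onePlus (suc n) 1 n
           ⊗ prodAP onePlus (2 * n + 2) 2 N
           ⊗ prodAP geom (suc n) 1 n
           ⊗ prodAP geom (2 * n + 2) 2 N) N

sptbarω : ℕ → ℕ
sptbarω N = Σℕ (map (λ i → sptbarωTerm N (suc i)) (upTo N))

-- x ↦ f(x/7) with the convention f(x) = 0 if x is not a positive integer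
-- (for x = 0 the generating functions have zero constant term anyway,
-- but we set it to 0 explicitly).
atDiv7 : (ℕ → ℕ) → ℕ → ℕ
atDiv7 f n = if does (7 ∣? n) then (if does (n ≟ 0) then 0 else f (n / 7)) else 0

{-# OPTIONS --safe #-}

-- Modulo 4 the product of the factors (1 + q^k)/(1 - q^k) = 1 + 2 q^k/(1 - q^k) is
-- 1 + 2 Σ q^k/(1 - q^k), so sptbar(N) ≡ σ(N) + 2 c(N), where c(N) counts modulo 2 the
-- solutions of a x + (a + b) y = N in positive integers, weighted by x.  Elementary
-- symmetries of this equation give
--   c(N) ≡ #{u² + 2v² = N} + #{2u² + 2v² = N}  (mod 2),  u, v ≥ 1,
-- and the count for sptbarω differs from c(N) by e(N), which counts the solutions of
-- a x + (2a + b) y = N weighted by x b.  The exchange (a, x) ↔ (y, b) leaves only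
-- its fixed points modulo 2, so e(N) ≡ #{4u² = N} + #{8u² = N}.
-- Since -1 and -2 are not squares modulo 7, each of these counts takes the same value
-- at 7n and at n/7, and σ(7n) + 7 σ(n/7) = 8 σ(n) does the same for σ modulo 4.
module Submission where

open import Defs
open import Algebra.Bundles using (CommutativeSemigroup)
import Algebra.Properties.CommutativeSemigroup as CommutativeSemigroupProperties
open import Data.Bool using (if_then_else_)
open import Data.Fin using (Fin; toℕ; fromℕ<)
open import Data.Fin.Properties using (toℕ-fromℕ<; all?)
open import Data.List using (map; upTo; applyUpTo)
open import Data.List.Properties using (map-upTo)
open import Data.Nat
open import Data.Nat.DivMod using ([m+kn]%n≡m%n; m*n/n≡m; m%n<n; m≡m%n+[m/n]*n)
open import Data.Nat.Divisibility
open import Data.Nat.Primality using (Prime; prime?; euclidsLemma)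
open import Data.Nat.Properties
open import Data.Nat.Tactic.RingSolver using (solve-∀)
open import Data.Product using (_×_; _,_; proj₁; proj₂)
open import Data.Sum using ([_,_]′; inj₁; inj₂)
open import Function using (_∘_; _$_; it)
open import Relation.Binary using (Setoid)
open import Relation.Binary.Definitions using (tri<; tri≈; tri>)
open import Relation.Binary.PropositionalEquality hiding ([_])
import Relation.Binary.Reasoning.Setoid as SetoidReasoning
open import Relation.Nullary using (Dec; does; yes; no; ¬_; contradiction)
open import Relation.Nullary.Decidable
  using (dec-true; dec-false; from-yes; from-no; _→-dec_; _×-dec_)

private variable
  P Q : Set
  m n a b c d N : ℕ
  f g f′ g′ : ℕ → ℕ

-- Iverson brackets

⟦_⟧ : Dec P → ℕ
⟦ p? ⟧ = if does p? then 1 else 0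

⟦⟧-true : (p? : Dec P) → P → ⟦ p? ⟧ ≡ 1
⟦⟧-true p? p rewrite dec-true p? p = refl

⟦⟧-false : (p? : Dec P) → ¬ P → ⟦ p? ⟧ ≡ 0
⟦⟧-false p? ¬p rewrite dec-false p? ¬p = refl

⟦⟧-cong : (p? : Dec P) (q? : Dec Q) → (P → Q) → (Q → P) → ⟦ p? ⟧ ≡ ⟦ q? ⟧
⟦⟧-cong (yes p) q? p⇒q _   = sym (⟦⟧-true q? (p⇒q p))
⟦⟧-cong (no ¬p) q? _   q⇒p = sym (⟦⟧-false q? (¬p ∘ q⇒p))

-- Finite sums

-- The index starts at 1.
∑ : ℕ → (ℕ → ℕ) → ℕ
∑ zero    f = 0
∑ (suc N) f = f 1 + ∑ N (f ∘ suc)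

syntax ∑ N (λ i → e) = ∑[ i ≤ N ] e
infix 6.5 ∑

-- One induction serves both equality and congruence modulo `m`. The bounds on `i` are passed on
-- because many summands agree only for positive indices or only up to `N`.
∑-lift : (_∼_ : ℕ → ℕ → Set) → 0 ∼ 0 →
         (∀ {a b c d} → a ∼ b → c ∼ d → (a + c) ∼ (b + d)) →
         ∀ N → (∀ i → 0 < i → i ≤ N → f i ∼ g i) → ∑ N f ∼ ∑ N g
∑-lift _∼_ 0∼0 +-mono zero    f∼g = 0∼0
∑-lift _∼_ 0∼0 +-mono (suc N) f∼g =
  +-mono (f∼g 1 z<s (s≤s z≤n))
         (∑-lift _∼_ 0∼0 +-mono N (λ i _ i≤N → f∼g (suc i) z<s (s≤s i≤N)))

∑-cong-≤ : ∀ N → (∀ i → 0 < i → i ≤ N → f i ≡ g i) → ∑ N f ≡ ∑ N g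
∑-cong-≤ = ∑-lift _≡_ refl (cong₂ _+_)

∑-cong : ∀ N → (∀ i → f i ≡ g i) → ∑ N f ≡ ∑ N g
∑-cong N f≡g = ∑-cong-≤ N (λ i _ _ → f≡g i)

∑-0 : ∀ N → (∀ i → 0 < i → i ≤ N → f i ≡ 0) → ∑ N f ≡ 0
∑-0 zero    f≡0 = refl
∑-0 (suc N) f≡0 =
  cong₂ _+_ (f≡0 1 z<s (s≤s z≤n)) (∑-0 N (λ i _ i≤N → f≡0 (suc i) z<s (s≤s i≤N)))

∑-+ : ∀ N f g → ∑[ i ≤ N ] (f i + g i) ≡ ∑ N f + ∑ N g
∑-+ zero    f g = refl
∑-+ (suc N) f g rewrite ∑-+ N (f ∘ suc) (g ∘ suc) =
  lemma (f 1) (g 1) (∑ N (f ∘ suc)) (∑ N (g ∘ suc))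
  where
  lemma : ∀ p q r s → p + q + (r + s) ≡ p + r + (q + s)
  lemma = solve-∀

∑-+₃ : ∀ N f g h → ∑[ i ≤ N ] (f i + g i + h i) ≡ ∑ N f + ∑ N g + ∑ N h
∑-+₃ N f g h = trans (∑-+ N (λ i → f i + g i) h) (cong (_+ ∑ N h) (∑-+ N f g))

∑-* : ∀ N k f → ∑[ i ≤ N ] (k * f i) ≡ k * ∑ N f
∑-* zero    k f = sym (*-zeroʳ k)
∑-* (suc N) k f rewrite ∑-* N k (f ∘ suc) = sym (*-distribˡ-+ k (f 1) (∑ N (f ∘ suc)))

∑-*ʳ : ∀ N k f → (∑ N f) * k ≡ ∑[ i ≤ N ] (f i * k)
∑-*ʳ N k f = trans (*-comm (∑ N f) k)
  (trans (sym (∑-* N k f)) (∑-cong N λ i → *-comm k (f i)))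

∑-swap : ∀ M N (f : ℕ → ℕ → ℕ) → ∑[ i ≤ M ] ∑[ j ≤ N ] f i j ≡ ∑[ j ≤ N ] ∑[ i ≤ M ] f i j
∑-swap zero    N f = sym (∑-0 N (λ _ _ _ → refl))
∑-swap (suc M) N f = trans (cong (∑ N (f 1) +_) (∑-swap M N (f ∘ suc)))
                           (sym (∑-+ N (f 1) (λ j → ∑ M (λ i → f (suc i) j))))

∑-split : ∀ m n f → ∑ (m + n) f ≡ ∑ m f + ∑[ i ≤ n ] f (m + i)
∑-split zero    n f = refl
∑-split (suc m) n f = trans (cong (f 1 +_) (∑-split m n (f ∘ suc))) (sym (+-assoc (f 1) _ _))

-- All the sums here stand for infinite sums whose terms vanish beyond some point; this is what
-- allows their cut-offs to be moved.
∑-extend : ∀ {M N f} → M ≤ N → (∀ i → M < i → f i ≡ 0) → ∑ N f ≡ ∑ M f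
∑-extend {M} {N} {f} M≤N f≡0 = begin
  ∑ N f                                ≡⟨ cong (λ n → ∑ n f) (m+[n∸m]≡n M≤N) ⟨
  ∑ (M + (N ∸ M)) f                    ≡⟨ ∑-split M (N ∸ M) f ⟩
  ∑ M f + ∑[ i ≤ N ∸ M ] f (M + i)     ≡⟨ cong (∑ M f +_) (∑-0 (N ∸ M) λ i 0<i _ → f≡0 _ (m<m+n M 0<i)) ⟩
  ∑ M f + 0                            ≡⟨ +-identityʳ _ ⟩
  ∑ M f                                ∎
  where open ≡-Reasoning

-- The condition on `N < m` replaces a bound on `m`: if `m` lies outside the range, the sum is 0,
-- and then `f m` has to be 0 as well.
∑-δ : ∀ N m (f : ℕ → ℕ) → 0 < m → (N < m → f m ≡ 0) → ∑[ i ≤ N ] (⟦ m ≟ i ⟧ * f i) ≡ f m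
∑-δ zero    m             f 0<m f≡0 = sym (f≡0 0<m)
∑-δ (suc N) 1             f 0<m f≡0 = trans (cong (f 1 + 0 +_) (∑-0 N λ { (suc i) _ _ → refl }))
                                            (trans (+-identityʳ _) (+-identityʳ _))
∑-δ (suc N) (suc (suc m)) f 0<m f≡0 = ∑-δ N (suc m) (f ∘ suc) z<s (f≡0 ∘ s≤s)

∑-unique : ∀ {P : ℕ → Set} (P? : ∀ i → Dec (P i)) → 0 < m → m ≤ N → P m → (∀ i → P i → m ≡ i) →
           ∑[ i ≤ N ] ⟦ P? i ⟧ ≡ 1
∑-unique {m} {N} {P} P? 0<m m≤N Pm unique = trans
  (∑-cong N λ i → trans (⟦⟧-cong (P? i) (m ≟ i) (unique i) λ { refl → Pm }) (sym (*-identityʳ _)))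
  (∑-δ N m (λ _ → 1) 0<m λ N<m → contradiction m≤N (<⇒≱ N<m))

-- A positive multiple of `k` has exactly one quotient, and that quotient lies between 1 and `N`.
-- Divisibility thus becomes a sum that can be exchanged with others.
∑-∣ : ∀ k a → 0 < a → a ≤ N → .{{NonZero k}} → ∑[ b ≤ N ] ⟦ k * b ≟ a ⟧ ≡ ⟦ k ∣? a ⟧
∑-∣ {N} k a 0<a a≤N with k ∣? a
... | yes (divides zero eq) = contradiction 0<a (subst (λ z → ¬ 0 < z) (sym eq) λ ())
... | yes (divides (suc q) refl) = ∑-unique (λ b → k * b ≟ suc q * k) z<s
        (≤-trans (m≤m*n (suc q) k) a≤N) (*-comm k (suc q))
        (λ b eq → sym (*-cancelˡ-≡ b (suc q) k (trans eq (*-comm (suc q) k))))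
... | no k∤a = ∑-0 N λ b _ _ → ⟦⟧-false (k * b ≟ a) λ { refl → k∤a (m∣m*n b) }

-- Expand the bracket by `∑-∣`, exchange the sums and collapse the sum over `a`. Indices `k * b`
-- beyond `N` do occur on the right, so `f` has to vanish there.
∑-multiples : ∀ N k (f : ℕ → ℕ) .{{_ : NonZero k}} → (∀ i → N < i → f i ≡ 0) →
              ∑[ a ≤ N ] (⟦ k ∣? a ⟧ * f a) ≡ ∑[ b ≤ N ] f (k * b)
∑-multiples N k f f≡0 = begin
  ∑[ a ≤ N ] (⟦ k ∣? a ⟧ * f a)
    ≡⟨ ∑-cong-≤ N (λ a 0<a a≤N → cong (_* f a) (sym (∑-∣ k a 0<a a≤N))) ⟩
  ∑[ a ≤ N ] ((∑[ b ≤ N ] ⟦ k * b ≟ a ⟧) * f a)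
    ≡⟨ ∑-cong N (λ a → ∑-*ʳ N (f a) _) ⟩
  ∑[ a ≤ N ] ∑[ b ≤ N ] (⟦ k * b ≟ a ⟧ * f a)
    ≡⟨ ∑-swap N N _ ⟩
  ∑[ b ≤ N ] ∑[ a ≤ N ] (⟦ k * b ≟ a ⟧ * f a)
    ≡⟨ ∑-cong-≤ N (λ { (suc b) 0<b _ → ∑-δ N (k * suc b) f (0<k*suc k b) (f≡0 (k * suc b)) }) ⟩
  ∑[ b ≤ N ] f (k * b) ∎
  where
  open ≡-Reasoning
  0<k*suc : ∀ k b .{{_ : NonZero k}} → 0 < k * suc b
  0<k*suc (suc k) b = z<s

∑-< : ∀ y X → X ≤ N → ∑[ x ≤ N ] ⟦ x + y ≟ X ⟧ ≡ ⟦ y <? X ⟧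
∑-< {N} y X X≤N with y <? X
... | no y≮X = trans (∑-0 N λ x 0<x _ → ⟦⟧-false (x + y ≟ X) λ { refl → y≮X (m<n+m y 0<x) })
                     (sym (⟦⟧-false (y <? X) y≮X))
... | yes y<X = trans (∑-unique (λ x → x + y ≟ X) (m<n⇒0<n∸m y<X) (≤-trans (m∸n≤m X y) X≤N)
                        (m∸n+n≡m (<⇒≤ y<X)) (λ { x refl → m+n∸n≡m x y }))
                      (sym (⟦⟧-true (y <? X) y<X))

∑-≤ : ∀ s → s ≤ N → ∑[ x ≤ N ] ⟦ x ≤? s ⟧ ≡ s
∑-≤ {N} s s≤N = begin
  ∑[ x ≤ N ] ⟦ x ≤? s ⟧  ≡⟨ ∑-extend s≤N (λ x s<x → ⟦⟧-false (x ≤? s) (<⇒≱ s<x)) ⟩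
  ∑[ x ≤ s ] ⟦ x ≤? s ⟧  ≡⟨ ∑-cong-≤ s (λ x _ x≤s → ⟦⟧-true (x ≤? s) x≤s) ⟩
  ∑[ x ≤ s ] 1           ≡⟨ const1 s ⟩
  s ∎
  where
  open ≡-Reasoning
  const1 : ∀ s → ∑[ x ≤ s ] 1 ≡ s
  const1 zero    = refl
  const1 (suc s) = cong suc (const1 s)

-- The substitution `X = x + y`: by `∑-<` the bracket for `y < X` counts the one positive `x` that
-- achieves it.
∑-sum : ∀ N (f : ℕ → ℕ → ℕ) → (∀ X y → N < X → f X y ≡ 0) →
        ∑[ X ≤ N ] ∑[ y ≤ N ] (⟦ y <? X ⟧ * f X y) ≡ ∑[ y ≤ N ] ∑[ x ≤ N ] f (x + y) y
∑-sum N f f≡0 = begin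
  ∑[ X ≤ N ] ∑[ y ≤ N ] (⟦ y <? X ⟧ * f X y)
    ≡⟨ ∑-cong-≤ N (λ X _ X≤N → ∑-cong N λ y → cong (_* f X y) (sym (∑-< y X X≤N))) ⟩
  ∑[ X ≤ N ] ∑[ y ≤ N ] ((∑[ x ≤ N ] ⟦ x + y ≟ X ⟧) * f X y)
    ≡⟨ ∑-cong N (λ X → ∑-cong N λ y → ∑-*ʳ N (f X y) _) ⟩
  ∑[ X ≤ N ] ∑[ y ≤ N ] ∑[ x ≤ N ] (⟦ x + y ≟ X ⟧ * f X y)
    ≡⟨ ∑-swap N N _ ⟩
  ∑[ y ≤ N ] ∑[ X ≤ N ] ∑[ x ≤ N ] (⟦ x + y ≟ X ⟧ * f X y)
    ≡⟨ ∑-cong N (λ y → ∑-swap N N _) ⟩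
  ∑[ y ≤ N ] ∑[ x ≤ N ] ∑[ X ≤ N ] (⟦ x + y ≟ X ⟧ * f X y)
    ≡⟨ ∑-cong N (λ y → ∑-cong-≤ N λ x 0<x _ →
         ∑-δ N (x + y) (λ X → f X y) (≤-trans 0<x (m≤m+n x y)) (f≡0 (x + y) y)) ⟩
  ∑[ y ≤ N ] ∑[ x ≤ N ] f (x + y) y ∎
  where open ≡-Reasoning

-- The square is cut along its diagonal, and each open half is parametrised by its smaller
-- coordinate and the positive difference.
∑-trichotomy : ∀ N (f : ℕ → ℕ → ℕ) → (∀ X y → N < X → f X y ≡ 0) → (∀ X y → N < y → f X y ≡ 0) →
  ∑[ X ≤ N ] ∑[ y ≤ N ] f X y ≡
  ∑[ y ≤ N ] ∑[ x ≤ N ] f (x + y) y + ∑[ y ≤ N ] ∑[ x ≤ N ] f y (x + y) + ∑[ x ≤ N ] f x x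
∑-trichotomy N f f≡0ˡ f≡0ʳ = begin
  ∑[ X ≤ N ] ∑[ y ≤ N ] f X y
    ≡⟨ ∑-cong N (λ X → ∑-cong N λ y → cases X y) ⟩
  ∑[ X ≤ N ] ∑[ y ≤ N ] (⟦ y <? X ⟧ * f X y + ⟦ X <? y ⟧ * f X y + ⟦ X ≟ y ⟧ * f X y)
    ≡⟨ ∑-cong N (λ X → ∑-+₃ N _ _ _) ⟩
  ∑[ X ≤ N ] (∑[ y ≤ N ] (⟦ y <? X ⟧ * f X y) + ∑[ y ≤ N ] (⟦ X <? y ⟧ * f X y)
              + ∑[ y ≤ N ] (⟦ X ≟ y ⟧ * f X y))
    ≡⟨ ∑-+₃ N _ _ _ ⟩
  ∑[ X ≤ N ] ∑[ y ≤ N ] (⟦ y <? X ⟧ * f X y) + ∑[ X ≤ N ] ∑[ y ≤ N ] (⟦ X <? y ⟧ * f X y)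
    + ∑[ X ≤ N ] ∑[ y ≤ N ] (⟦ X ≟ y ⟧ * f X y)
    ≡⟨ cong₂ _+_ (cong₂ _+_ (∑-sum N f f≡0ˡ)
         (trans (∑-swap N N _) (∑-sum N (λ y X → f X y) (λ y X → f≡0ʳ X y))))
         (∑-cong-≤ N λ X 0<X _ → ∑-δ N X (f X) 0<X (f≡0ʳ X X)) ⟩
  ∑[ y ≤ N ] ∑[ x ≤ N ] f (x + y) y + ∑[ y ≤ N ] ∑[ x ≤ N ] f y (x + y) + ∑[ x ≤ N ] f x x ∎
  where
  open ≡-Reasoning
  cases : ∀ X y → f X y ≡ ⟦ y <? X ⟧ * f X y + ⟦ X <? y ⟧ * f X y + ⟦ X ≟ y ⟧ * f X y
  cases X y with <-cmp X y
  ... | tri< X<y X≢y y≮X rewrite ⟦⟧-true (X <? y) X<y | ⟦⟧-false (X ≟ y) X≢y | ⟦⟧-false (y <? X) y≮X =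
        sym (trans (+-identityʳ _) (+-identityʳ _))
  ... | tri≈ X≮y X≡y y≮X rewrite ⟦⟧-false (X <? y) X≮y | ⟦⟧-true (X ≟ y) X≡y | ⟦⟧-false (y <? X) y≮X =
        sym (+-identityʳ _)
  ... | tri> X≮y X≢y y<X rewrite ⟦⟧-false (X <? y) X≮y | ⟦⟧-false (X ≟ y) X≢y | ⟦⟧-true (y <? X) y<X =
        sym (trans (+-identityʳ _) (trans (+-identityʳ _) (+-identityʳ _)))

-- Congruences

infix 4 _≈_[mod_]
-- Multiples of `m` may be added on both sides, which avoids subtraction in `ℕ` and makes symmetry
-- immediate.
record _≈_[mod_] (a b m : ℕ) : Set where
  constructor congruent
  field
    {i j} : ℕ
    eq    : a + m * i ≡ b + m * j

≈-refl : a ≈ a [mod m ]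
≈-refl = congruent {i = 0} {j = 0} refl

≡⇒≈ : a ≡ b → a ≈ b [mod m ]
≡⇒≈ refl = ≈-refl

≈-sym : a ≈ b [mod m ] → b ≈ a [mod m ]
≈-sym (congruent eq) = congruent (sym eq)

≈-+ : a ≈ b [mod m ] → c ≈ d [mod m ] → a + c ≈ b + d [mod m ]
≈-+ {a} {b} {m} {c} {d} (congruent {k} {l} p) (congruent {k′} {l′} q) =
  congruent (trans (lemma a c m k k′) (trans (cong₂ _+_ p q) (sym (lemma b d m l l′))))
  where
  lemma : ∀ a c m k k′ → a + c + m * (k + k′) ≡ a + m * k + (c + m * k′)
  lemma = solve-∀

≈-trans : a ≈ b [mod m ] → b ≈ c [mod m ] → a ≈ c [mod m ]
≈-trans {a} {b} {m} {c} (congruent {k} {l} p) (congruent {k′} {l′} q) =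
  congruent (trans (lemma₁ a m k k′) (trans (cong (_+ m * k′) p)
    (trans (lemma₂ b m l k′) (trans (cong (_+ m * l) q) (sym (lemma₁ c m l′ l))))))
  where
  lemma₁ : ∀ a m k k′ → a + m * (k + k′) ≡ a + m * k + m * k′
  lemma₁ = solve-∀
  lemma₂ : ∀ b m l k′ → b + m * l + m * k′ ≡ b + m * k′ + m * l
  lemma₂ = solve-∀

≈-* : ∀ c → a ≈ b [mod m ] → c * a ≈ c * b [mod m ]
≈-* {a} {b} {m} c (congruent {k} {l} p) =
  congruent (trans (lemma c a m k) (trans (cong (c *_) p) (sym (lemma c b m l))))
  where
  lemma : ∀ c a m k → c * a + m * (c * k) ≡ c * (a + m * k)
  lemma = solve-∀

≈-*ʳ : ∀ c → a ≈ b [mod m ] → a * c ≈ b * c [mod m ]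
≈-*ʳ {a} {b} {m} c p = subst₂ (_≈_[mod m ]) (*-comm c a) (*-comm c b) (≈-* c p)

-- With `c = 2` this lifts parities to congruences modulo 4. It is the reason why every count that
-- appears with a factor 2 need only be known modulo 2.
≈-scale : ∀ c → a ≈ b [mod m ] → c * a ≈ c * b [mod c * m ]
≈-scale {a} {b} {m} c (congruent {k} {l} p) =
  congruent (trans (lemma c a m k) (trans (cong (c *_) p) (sym (lemma c b m l))))
  where
  lemma : ∀ c a m k → c * a + (c * m) * k ≡ c * (a + m * k)
  lemma = solve-∀

≈⇒% : .{{_ : NonZero m}} → a ≈ b [mod m ] → a % m ≡ b % m
≈⇒% {m} {a} {b} (congruent {k} {l} p) = begin
  a % m           ≡⟨ [m+kn]%n≡m%n a k m ⟨
  (a + k * m) % m ≡⟨ cong (λ z → (a + z) % m) (*-comm k m) ⟩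
  (a + m * k) % m ≡⟨ cong (_% m) p ⟩
  (b + m * l) % m ≡⟨ cong (λ z → (b + z) % m) (*-comm m l) ⟩
  (b + l * m) % m ≡⟨ [m+kn]%n≡m%n b l m ⟩
  b % m           ∎
  where open ≡-Reasoning

≈-setoid : ℕ → Setoid _ _
≈-setoid m = record
  { Carrier = ℕ ; _≈_ = _≈_[mod m ]
  ; isEquivalence = record { refl = ≈-refl ; sym = ≈-sym ; trans = ≈-trans } }

module ≈-Reasoning (m : ℕ) = SetoidReasoning (≈-setoid m)

∑-≈ : ∀ N → (∀ i → 0 < i → i ≤ N → f i ≈ g i [mod m ]) → ∑ N f ≈ ∑ N g [mod m ]
∑-≈ {m = m} = ∑-lift _≈_[mod m ] ≈-refl ≈-+

-- Counting modulo 2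

2+n≈n : ∀ n → 2 + n ≈ n [mod 2 ]
2+n≈n n = congruent {i = 0} {j = 1} (lemma n)
  where
  lemma : ∀ n → 2 + n + 2 * 0 ≡ n + 2 * 1
  lemma = solve-∀

n≈1+even : ∀ n → n ≈ 1 + ⟦ 2 ∣? n ⟧ [mod 2 ]
n≈1+even zero = congruent {i = 1} {j = 0} refl
n≈1+even 1 = ≈-refl
n≈1+even (suc (suc n)) = ≈-trans (2+n≈n n) (n≈1+even n)

1+n≈even : ∀ n → 1 + n ≈ ⟦ 2 ∣? n ⟧ [mod 2 ]
1+n≈even n = ≈-trans (≈-+ (≈-refl {1}) (n≈1+even n)) (2+n≈n _)

n*[1+n]≈0 : ∀ n → n * (1 + n) ≈ 0 [mod 2 ]
n*[1+n]≈0 zero = ≈-refl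
n*[1+n]≈0 (suc n) = ≈-trans (congruent {i = 0} {j = 1 + n} (lemma n)) (n*[1+n]≈0 n)
  where
  lemma : ∀ n → suc n * (1 + suc n) + 2 * 0 ≡ n * (1 + n) + 2 * (1 + n)
  lemma = solve-∀

n*n≈n : ∀ n → n * n ≈ n [mod 2 ]
n*n≈n n = begin
  n * n              ≈⟨ congruent {i = n} {j = 0} (lemma n) ⟩
  n * (1 + n) + n    ≈⟨ ≈-+ (n*[1+n]≈0 n) ≈-refl ⟩
  n                  ∎
  where
  open ≈-Reasoning 2
  lemma : ∀ n → n * n + 2 * n ≡ n * (1 + n) + n + 2 * 0
  lemma = solve-∀

∑-even : ∀ N f → (∀ i → N < i → f i ≡ 0) →
         ∑[ i ≤ N ] ((1 + i) * f i) ≈ ∑[ i ≤ N ] f (2 * i) [mod 2 ]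
∑-even N f f≡0 = begin
  ∑[ i ≤ N ] ((1 + i) * f i)       ≈⟨ ∑-≈ N (λ i _ _ → ≈-*ʳ (f i) (1+n≈even i)) ⟩
  ∑[ i ≤ N ] (⟦ 2 ∣? i ⟧ * f i)    ≡⟨ ∑-multiples N 2 f f≡0 ⟩
  ∑[ i ≤ N ] f (2 * i)             ∎
  where open ≈-Reasoning 2

-- The weight `i` selects the odd indices, and modulo 2 removing the even ones is the same as adding
-- them once more.
∑-odd : ∀ N f → (∀ i → N < i → f i ≡ 0) →
        ∑[ i ≤ N ] (i * f i) ≈ ∑ N f + ∑[ i ≤ N ] f (2 * i) [mod 2 ]
∑-odd N f f≡0 = begin
  ∑[ i ≤ N ] (i * f i)                     ≈⟨ ∑-≈ N (λ i _ _ → ≈-*ʳ (f i) (n≈1+even i)) ⟩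
  ∑[ i ≤ N ] (f i + ⟦ 2 ∣? i ⟧ * f i)      ≡⟨ ∑-+ N f _ ⟩
  ∑ N f + ∑[ i ≤ N ] (⟦ 2 ∣? i ⟧ * f i)    ≡⟨ cong (∑ N f +_) (∑-multiples N 2 f f≡0) ⟩
  ∑ N f + ∑[ i ≤ N ] f (2 * i)             ∎
  where open ≈-Reasoning 2

-- Off-diagonal terms cancel in pairs. The induction peels off the first row and the first column,
-- whose parts off the diagonal both equal `u`.
∑-symmetric : ∀ N (f : ℕ → ℕ → ℕ) → (∀ i j → f i j ≡ f j i) →
              ∑[ i ≤ N ] ∑[ j ≤ N ] f i j ≈ ∑[ i ≤ N ] f i i [mod 2 ]
∑-symmetric zero    f f-sym = ≈-refl
∑-symmetric (suc N) f f-sym = begin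
  f 1 1 + u + ∑[ i ≤ N ] (f (suc i) 1 + ∑[ j ≤ N ] f (suc i) (suc j))
    ≡⟨ cong (f 1 1 + u +_) (∑-+ N _ _) ⟩
  f 1 1 + u + ((∑[ i ≤ N ] f (suc i) 1) + s)
    ≡⟨ cong (λ z → f 1 1 + u + (z + s)) (∑-cong N λ i → f-sym (suc i) 1) ⟩
  f 1 1 + u + (u + s)
    ≈⟨ congruent {i = 0} {j = u} (lemma (f 1 1) u s) ⟩
  f 1 1 + s
    ≈⟨ ≈-+ (≈-refl {f 1 1}) (∑-symmetric N (λ i j → f (suc i) (suc j)) (λ i j → f-sym (suc i) (suc j))) ⟩
  f 1 1 + ∑[ i ≤ N ] f (suc i) (suc i) ∎
  where
  open ≈-Reasoning 2
  u = ∑[ j ≤ N ] f 1 (suc j)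
  s = ∑[ i ≤ N ] ∑[ j ≤ N ] f (suc i) (suc j)
  lemma : ∀ v u s → v + u + (u + s) + 2 * 0 ≡ v + s + 2 * u
  lemma = solve-∀

-- The involution exchanges `i` with `j` and `k` with `l` simultaneously. First the inner double sum
-- is symmetric in `i` and `j`; on the diagonal `i = j` the remaining summand is symmetric in `k`
-- and `l`.
∑-symmetric₂ : ∀ N (f : ℕ → ℕ → ℕ → ℕ → ℕ) → (∀ i j k l → f i j k l ≡ f j i l k) →
  ∑[ i ≤ N ] ∑[ j ≤ N ] ∑[ k ≤ N ] ∑[ l ≤ N ] f i j k l ≈ ∑[ i ≤ N ] ∑[ k ≤ N ] f i i k k [mod 2 ]
∑-symmetric₂ N f f-sym = begin
  ∑[ i ≤ N ] ∑[ j ≤ N ] ∑[ k ≤ N ] ∑[ l ≤ N ] f i j k l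
    ≈⟨ ∑-symmetric N _ (λ i j → trans (∑-cong N λ k → ∑-cong N λ l → f-sym i j k l) (∑-swap N N _)) ⟩
  ∑[ i ≤ N ] ∑[ k ≤ N ] ∑[ l ≤ N ] f i i k l
    ≈⟨ ∑-≈ N (λ i _ _ → ∑-symmetric N (f i i) (f-sym i i)) ⟩
  ∑[ i ≤ N ] ∑[ k ≤ N ] f i i k k ∎
  where open ≈-Reasoning 2

-- Modulo 2 the weights x, X and 1 + y stand for "x odd", "X odd" and "y even": a pair of
-- opposite parity is sorted by which entry is odd instead of by which entry is larger.
∑-fold : ∀ N (h : ℕ → ℕ → ℕ) → (∀ X y → h X y ≡ h y X) → (∀ X y → N < X → h X y ≡ 0) →
  ∑[ y ≤ N ] ∑[ x ≤ N ] (x * h (x + y) y) ≈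
  ∑[ X ≤ N ] ∑[ y ≤ N ] (X * ((1 + y) * h X y)) [mod 2 ]
∑-fold N h h-sym h≡0 = ≈-sym $ begin
  ∑[ X ≤ N ] ∑[ y ≤ N ] w X y
    ≡⟨ ∑-trichotomy N w (λ X y N<X → w≡0 X y (h≡0 X y N<X)) (λ X y N<y → w≡0 X y (trans (h-sym X y) (h≡0 y X N<y))) ⟩
  ∑[ y ≤ N ] ∑[ x ≤ N ] w (x + y) y + ∑[ y ≤ N ] ∑[ x ≤ N ] w y (x + y) + ∑[ x ≤ N ] w x x
    ≡⟨ cong (_+ ∑ N (λ x → w x x)) (trans (∑-cong N λ y → ∑-+ N _ _) (∑-+ N _ _)) ⟨
  ∑[ y ≤ N ] ∑[ x ≤ N ] (w (x + y) y + w y (x + y)) + ∑[ x ≤ N ] w x x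
    ≈⟨ ≈-+ (∑-≈ N λ y _ _ → ∑-≈ N λ x _ _ → off-diagonal x y)
           (∑-≈ {g = λ _ → 0} N λ x _ _ → diagonal x) ⟩
  ∑[ y ≤ N ] ∑[ x ≤ N ] (x * h (x + y) y) + ∑[ x ≤ N ] 0
    ≡⟨ cong (∑[ y ≤ N ] ∑[ x ≤ N ] (x * h (x + y) y) +_) (∑-0 N λ _ _ _ → refl) ⟩
  ∑[ y ≤ N ] ∑[ x ≤ N ] (x * h (x + y) y) + 0
    ≡⟨ +-identityʳ _ ⟩
  ∑[ y ≤ N ] ∑[ x ≤ N ] (x * h (x + y) y) ∎
  where
  open ≈-Reasoning 2
  w : ℕ → ℕ → ℕ
  w X y = X * ((1 + y) * h X y)
  w≡0 : ∀ X y → h X y ≡ 0 → w X y ≡ 0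
  w≡0 X y eq rewrite eq | *-zeroʳ (1 + y) = *-zeroʳ X
  off-diagonal : ∀ x y → w (x + y) y + w y (x + y) ≈ x * h (x + y) y [mod 2 ]
  -- The two weights add up to `(x + y) * (1 + y) + y * (1 + x + y) = x + 2 * (x * y + y + y * y)`,
  -- which gives the witness.
  off-diagonal x y rewrite h-sym y (x + y) = congruent {i = 0} {j = (x * y + y + y * y) * h (x + y) y}
    (lemma x y (h (x + y) y))
    where
    lemma : ∀ x y z → (x + y) * ((1 + y) * z) + y * ((1 + (x + y)) * z) + 2 * 0
                      ≡ x * z + 2 * ((x * y + y + y * y) * z)
    lemma = solve-∀
  diagonal : ∀ x → w x x ≈ 0 [mod 2 ]
  diagonal x = ≈-trans (≡⇒≈ (sym (*-assoc x (1 + x) (h x x)))) (≈-*ʳ (h x x) (n*[1+n]≈0 x))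

-- After `∑-fold` the weight `1 + y` leaves the even values `y = 2 * z`, and the weight `X` leaves
-- the odd values of `X`, that is, all of them plus the even ones modulo 2.
∑-fold-even : ∀ N (h : ℕ → ℕ → ℕ) → (∀ X y → h X y ≡ h y X) → (∀ X y → N < X → h X y ≡ 0) →
  ∑[ y ≤ N ] ∑[ x ≤ N ] (x * h (x + y) y) ≈
  ∑[ X ≤ N ] ∑[ z ≤ N ] h X (2 * z) + ∑[ X ≤ N ] ∑[ z ≤ N ] h (2 * X) (2 * z) [mod 2 ]
∑-fold-even N h h-sym h≡0 = begin
  ∑[ y ≤ N ] ∑[ x ≤ N ] (x * h (x + y) y)
    ≈⟨ ∑-fold N h h-sym h≡0 ⟩
  ∑[ X ≤ N ] ∑[ y ≤ N ] (X * ((1 + y) * h X y))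
    ≈⟨ ∑-≈ N (λ X _ _ → ≈-trans (≡⇒≈ (∑-* N X _))
         (≈-* X (∑-even N (h X) (λ y N<y → trans (h-sym X y) (h≡0 y X N<y))))) ⟩
  ∑[ X ≤ N ] (X * (∑[ z ≤ N ] h X (2 * z)))
    ≈⟨ ∑-odd N _ (λ X N<X → ∑-0 N λ z _ _ → h≡0 X (2 * z) N<X) ⟩
  ∑[ X ≤ N ] ∑[ z ≤ N ] h X (2 * z) + ∑[ X ≤ N ] ∑[ z ≤ N ] h (2 * X) (2 * z) ∎
  where open ≈-Reasoning 2

-- Representations by binary and unary forms

-- Both variables are positive since `∑` starts at 1. For `c ≥ 1` no solution exceeds the bound `N`.
r : ℕ → ℕ → ℕ
r c N = ∑[ a ≤ N ] ∑[ b ≤ N ] ⟦ c * (a * a) + 2 * (b * b) ≟ N ⟧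

s : ℕ → ℕ → ℕ
s c N = ∑[ a ≤ N ] ⟦ c * (a * a) ≟ N ⟧

-- This is the count c(N) of the overview. For fixed `a` the factor with exponent `a + b`
-- contributes the terms in `y`.
crossSum : ℕ → ℕ
crossSum N = ∑[ a ≤ N ] ∑[ b ≤ N ] ∑[ x ≤ N ] ∑[ y ≤ N ] (x * ⟦ a * x + (a + b) * y ≟ N ⟧)

-- This is e(N) of the overview. Modulo 2 the weight `b` selects the odd values of `2 * a + b`: the
-- odd exponents above `2 * a`, exactly those absent from the products for `sptbarω`.
oddCrossSum : ℕ → ℕ
oddCrossSum N = ∑[ a ≤ N ] ∑[ b ≤ N ] ∑[ x ≤ N ] ∑[ y ≤ N ] (b * (x * ⟦ a * x + (2 * a + b) * y ≟ N ⟧))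

⟦⟧-> : ∀ {v} → N < v → ⟦ v ≟ N ⟧ ≡ 0
⟦⟧-> {N} {v} N<v = ⟦⟧-false (v ≟ N) (>⇒≢ N<v)

⟦⟧-≡ : ∀ {u v} → u ≡ v → ⟦ u ≟ N ⟧ ≡ ⟦ v ≟ N ⟧
⟦⟧-≡ {N} u≡v = cong (λ z → ⟦ z ≟ N ⟧) u≡v

∑-swap₂ : ∀ N (f : ℕ → ℕ → ℕ → ℕ → ℕ) →
  ∑[ i ≤ N ] ∑[ j ≤ N ] ∑[ k ≤ N ] ∑[ l ≤ N ] f i j k l ≡
  ∑[ l ≤ N ] ∑[ k ≤ N ] ∑[ i ≤ N ] ∑[ j ≤ N ] f i j k l
∑-swap₂ N f = begin
  ∑[ i ≤ N ] ∑[ j ≤ N ] ∑[ k ≤ N ] ∑[ l ≤ N ] f i j k l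
    ≡⟨ ∑-cong N (λ i → ∑-cong N λ j → ∑-swap N N _) ⟩
  ∑[ i ≤ N ] ∑[ j ≤ N ] ∑[ l ≤ N ] ∑[ k ≤ N ] f i j k l
    ≡⟨ ∑-cong N (λ i → ∑-swap N N _) ⟩
  ∑[ i ≤ N ] ∑[ l ≤ N ] ∑[ j ≤ N ] ∑[ k ≤ N ] f i j k l
    ≡⟨ ∑-swap N N _ ⟩
  ∑[ l ≤ N ] ∑[ i ≤ N ] ∑[ j ≤ N ] ∑[ k ≤ N ] f i j k l
    ≡⟨ ∑-cong N (λ l → trans (∑-cong N λ i → ∑-swap N N _) (∑-swap N N _)) ⟩
  ∑[ l ≤ N ] ∑[ k ≤ N ] ∑[ i ≤ N ] ∑[ j ≤ N ] f i j k l ∎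
  where open ≡-Reasoning

-- Exchanging `X` with `a` and `z` with `b` preserves the equation. The fixed points have `a = X`
-- and `b = z`, where its left side becomes the quadratic form.
r≈∑ : ∀ c N → ∑[ X ≤ N ] ∑[ z ≤ N ] ∑[ a ≤ N ] ∑[ b ≤ N ] ⟦ a * (c * X) + b * (2 * z) ≟ N ⟧ ≈ r c N [mod 2 ]
r≈∑ c N = begin
  ∑[ X ≤ N ] ∑[ z ≤ N ] ∑[ a ≤ N ] ∑[ b ≤ N ] ⟦ a * (c * X) + b * (2 * z) ≟ N ⟧
    ≡⟨ ∑-cong N (λ X → ∑-swap N N _) ⟩
  ∑[ X ≤ N ] ∑[ a ≤ N ] ∑[ z ≤ N ] ∑[ b ≤ N ] ⟦ a * (c * X) + b * (2 * z) ≟ N ⟧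
    ≈⟨ ∑-symmetric₂ N _ (λ X a z b → ⟦⟧-≡ (swap c X a z b)) ⟩
  ∑[ X ≤ N ] ∑[ z ≤ N ] ⟦ X * (c * X) + z * (2 * z) ≟ N ⟧
    ≡⟨ ∑-cong N (λ X → ∑-cong N λ z → ⟦⟧-≡ (square c X z)) ⟩
  r c N ∎
  where
  open ≈-Reasoning 2
  swap : ∀ c X a z b → a * (c * X) + b * (2 * z) ≡ X * (c * a) + z * (2 * b)
  swap = solve-∀
  square : ∀ c X z → X * (c * X) + z * (2 * z) ≡ c * (X * X) + 2 * (z * z)
  square = solve-∀

-- Written as `a * (x + y) + b * y`, the equation depends on `x` only through `x + y`, and the
-- number `h X y` of solutions of `a * X + b * y = N` is symmetric in `X` and `y`. So `∑-fold-even`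
-- applies, and `r≈∑` evaluates its two terms.
crossSum≈r : ∀ N → crossSum N ≈ r 1 N + r 2 N [mod 2 ]
crossSum≈r N = begin
  ∑[ a ≤ N ] ∑[ b ≤ N ] ∑[ x ≤ N ] ∑[ y ≤ N ] (x * ⟦ a * x + (a + b) * y ≟ N ⟧)
    ≡⟨ ∑-swap₂ N _ ⟩
  ∑[ y ≤ N ] ∑[ x ≤ N ] ∑[ a ≤ N ] ∑[ b ≤ N ] (x * ⟦ a * x + (a + b) * y ≟ N ⟧)
    ≡⟨ ∑-cong N (λ y → ∑-cong N λ x → trans (∑-cong N λ a → ∑-* N x _) (∑-* N x _)) ⟩
  ∑[ y ≤ N ] ∑[ x ≤ N ] (x * (∑[ a ≤ N ] ∑[ b ≤ N ] ⟦ a * x + (a + b) * y ≟ N ⟧))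
    ≡⟨ ∑-cong N (λ y → ∑-cong N λ x → cong (x *_) (∑-cong N λ a → ∑-cong N λ b →
         ⟦⟧-≡ (regroup a b x y))) ⟩
  ∑[ y ≤ N ] ∑[ x ≤ N ] (x * h (x + y) y)
    ≈⟨ ∑-fold-even N h h-sym h≡0 ⟩
  ∑[ X ≤ N ] ∑[ z ≤ N ] h X (2 * z) + ∑[ X ≤ N ] ∑[ z ≤ N ] h (2 * X) (2 * z)
    ≡⟨ cong (_+ ∑[ X ≤ N ] ∑[ z ≤ N ] h (2 * X) (2 * z)) (∑-cong N λ X → ∑-cong N λ z →
         cong (λ w → h w (2 * z)) (sym (*-identityˡ X))) ⟩
  ∑[ X ≤ N ] ∑[ z ≤ N ] h (1 * X) (2 * z) + ∑[ X ≤ N ] ∑[ z ≤ N ] h (2 * X) (2 * z)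
    ≈⟨ ≈-+ (r≈∑ 1 N) (r≈∑ 2 N) ⟩
  r 1 N + r 2 N ∎
  where
  open ≈-Reasoning 2
  h : ℕ → ℕ → ℕ
  h X y = ∑[ a ≤ N ] ∑[ b ≤ N ] ⟦ a * X + b * y ≟ N ⟧
  h-sym : ∀ X y → h X y ≡ h y X
  h-sym X y = trans (∑-swap N N _) (∑-cong N λ a → ∑-cong N λ b → ⟦⟧-≡ (+-comm (b * X) (a * y)))
  h≡0 : ∀ X y → N < X → h X y ≡ 0
  h≡0 X y N<X = ∑-0 N λ { a@(suc _) _ _ → ∑-0 N λ b _ _ →
    ⟦⟧-> (≤-trans N<X (≤-trans (m≤n*m X a) (m≤m+n _ _))) }
  regroup : ∀ a b x y → a * x + (a + b) * y ≡ a * (x + y) + b * y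
  regroup = solve-∀

-- Parity arguments are applied three times: the exchange of `(a , x)` with `(y , b)`, then the
-- folding of `x + a` against `a`, and finally the exchange of the two factors of the resulting
-- product.
oddCrossSum≈s : ∀ N → 0 < N → oddCrossSum N ≈ s 4 N + s 8 N [mod 2 ]
oddCrossSum≈s N 0<N = begin
  ∑[ a ≤ N ] ∑[ b ≤ N ] ∑[ x ≤ N ] ∑[ y ≤ N ] (b * (x * ⟦ a * x + (2 * a + b) * y ≟ N ⟧))
    -- The order `a`, `y`, `x`, `b` puts the variables to be exchanged next to each other, as
    -- `∑-symmetric₂` requires.
    ≡⟨ ∑-cong N (λ a → trans (∑-cong N λ b → ∑-swap N N _) (trans (∑-swap N N _)
         (∑-cong N λ y → ∑-swap N N _))) ⟩
  ∑[ a ≤ N ] ∑[ y ≤ N ] ∑[ x ≤ N ] ∑[ b ≤ N ] (b * (x * ⟦ a * x + (2 * a + b) * y ≟ N ⟧))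
    ≈⟨ ∑-symmetric₂ N _ (λ a y x b → trans (weights b x _) (cong (λ z → x * (b * z)) (⟦⟧-≡ (swap a y x b)))) ⟩
  ∑[ a ≤ N ] ∑[ x ≤ N ] (x * (x * ⟦ a * x + (2 * a + x) * a ≟ N ⟧))
    -- On the fixed points the weights `b` and `x` coincide, and their product `x * x` has the
    -- parity of `x`.
    ≈⟨ ∑-≈ N (λ a _ _ → ∑-≈ N λ x _ _ → ≈-trans (≡⇒≈ (sym (*-assoc x x _)))
         (≈-trans (≈-*ʳ _ (n*n≈n x)) (≡⇒≈ (cong (x *_) (⟦⟧-≡ (diagonal a x)))))) ⟩
  ∑[ a ≤ N ] ∑[ x ≤ N ] (x * h (x + a) a)
    ≈⟨ ∑-fold-even N h (λ X y → ⟦⟧-≡ (cong (2 *_) (*-comm X y))) h≡0 ⟩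
  ∑[ X ≤ N ] ∑[ z ≤ N ] h X (2 * z) + ∑[ X ≤ N ] ∑[ z ≤ N ] h (2 * X) (2 * z)
    ≈⟨ ≈-+ (∑-symmetric N _ (λ X z → ⟦⟧-≡ (sym₄ X z))) (∑-symmetric N _ (λ X z → ⟦⟧-≡ (sym₈ X z))) ⟩
  ∑[ X ≤ N ] h X (2 * X) + ∑[ X ≤ N ] h (2 * X) (2 * X)
    ≡⟨ cong₂ _+_ (∑-cong N λ X → ⟦⟧-≡ (square₄ X)) (∑-cong N λ X → ⟦⟧-≡ (square₈ X)) ⟩
  s 4 N + s 8 N ∎
  where
  open ≈-Reasoning 2
  h : ℕ → ℕ → ℕ
  h X y = ⟦ 2 * (X * y) ≟ N ⟧
  h≡0 : ∀ X y → N < X → h X y ≡ 0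
  -- At `y = 0` the bracket compares 0 with `N`, so it vanishes only because `N` is positive.
  h≡0 X zero    N<X = trans (⟦⟧-≡ (cong (2 *_) (*-zeroʳ X))) (⟦⟧-false (0 ≟ N) (<⇒≢ 0<N))
  h≡0 X (suc y) N<X = ⟦⟧-> (≤-trans N<X (≤-trans (m≤m*n X (suc y)) (m≤n*m (X * suc y) 2)))
  weights : ∀ b x v → b * (x * v) ≡ x * (b * v)
  weights = solve-∀
  swap : ∀ a y x b → a * x + (2 * a + b) * y ≡ y * b + (2 * y + x) * a
  swap = solve-∀
  diagonal : ∀ a x → a * x + (2 * a + x) * a ≡ 2 * ((x + a) * a)
  diagonal = solve-∀
  sym₄ : ∀ X z → 2 * (X * (2 * z)) ≡ 2 * (z * (2 * X))
  sym₄ = solve-∀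
  sym₈ : ∀ X z → 2 * ((2 * X) * (2 * z)) ≡ 2 * ((2 * z) * (2 * X))
  sym₈ = solve-∀
  square₄ : ∀ X → 2 * (X * (2 * X)) ≡ 4 * (X * X)
  square₄ = solve-∀
  square₈ : ∀ X → 2 * ((2 * X) * (2 * X)) ≡ 8 * (X * X)
  square₈ = solve-∀

-- Behaviour under multiplication by 7

atDiv7-∣ : ∀ (f : ℕ → ℕ) q → 0 < q → atDiv7 f (q * 7) ≡ f q
atDiv7-∣ f q@(suc _) _ rewrite dec-true (7 ∣? q * 7) (n∣m*n q) = cong f (m*n/n≡m q 7)

atDiv7-∤ : ∀ (f : ℕ → ℕ) → ¬ 7 ∣ n → atDiv7 f n ≡ 0
atDiv7-∤ {n} f 7∤n rewrite dec-false (7 ∣? n) 7∤n = refl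

data Div7View : ℕ → Set where
  multiple    : ∀ q → 0 < q → Div7View (q * 7)
  nonMultiple : ¬ 7 ∣ n → Div7View n

div7View : ∀ n → 0 < n → Div7View n
div7View n 0<n with 7 ∣? n
... | no 7∤n                     = nonMultiple 7∤n
... | yes (divides (suc q) refl) = multiple (suc q) z<s

-- The operators that send the coefficient at `n` to the one at `7 * n`, respectively at `n / 7`,
-- agree on `f` modulo `m`. The property passes to sums, multiples and congruent functions, so each
-- term can be treated alone.
record Periodic (m : ℕ) (f : ℕ → ℕ) : Set where
  constructor periodic
  field
    at-7* : ∀ n → 0 < n → f (7 * n) ≈ atDiv7 f n [mod m ]

open Periodic

-- The congruence is applied at `7 * n` and, if 7 divides `n`, at the quotient. Both are positive,
-- so agreement at positive arguments suffices.
periodic-resp : (∀ n → 0 < n → f n ≈ g n [mod m ]) → Periodic m g → Periodic m f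
periodic-resp {f} {g} {m} f≈g g-per = periodic λ n 0<n →
  ≈-trans (f≈g (7 * n) (≤-trans 0<n (m≤m+n n _))) (≈-trans (at-7* g-per n 0<n) (at n (div7View n 0<n)))
  where
  at : ∀ n → Div7View n → atDiv7 g n ≈ atDiv7 f n [mod m ]
  at _ (multiple q 0<q) rewrite atDiv7-∣ f q 0<q | atDiv7-∣ g q 0<q = ≈-sym (f≈g q 0<q)
  at _ (nonMultiple 7∤n) rewrite atDiv7-∤ f 7∤n | atDiv7-∤ g 7∤n = ≈-refl

periodic-+ : Periodic m f → Periodic m g → Periodic m (λ n → f n + g n)
periodic-+ {m} {f} {g} f-per g-per = periodic λ n 0<n →
  ≈-trans (≈-+ (at-7* f-per n 0<n) (at-7* g-per n 0<n)) (≡⇒≈ (at n (div7View n 0<n)))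
  where
  at : ∀ n → Div7View n → atDiv7 f n + atDiv7 g n ≡ atDiv7 (λ n → f n + g n) n
  at _ (multiple q 0<q)
    rewrite atDiv7-∣ f q 0<q | atDiv7-∣ g q 0<q | atDiv7-∣ (λ n → f n + g n) q 0<q = refl
  at _ (nonMultiple 7∤n)
    rewrite atDiv7-∤ f 7∤n | atDiv7-∤ g 7∤n | atDiv7-∤ (λ n → f n + g n) 7∤n = refl

periodic-* : ∀ c → Periodic m f → Periodic m (λ n → c * f n)
periodic-* {m} {f} c f-per = periodic λ n 0<n →
  ≈-trans (≈-* c (at-7* f-per n 0<n)) (≡⇒≈ (at n (div7View n 0<n)))
  where
  at : ∀ n → Div7View n → c * atDiv7 f n ≡ atDiv7 (λ n → c * f n) n
  at _ (multiple q 0<q) rewrite atDiv7-∣ f q 0<q | atDiv7-∣ (λ n → c * f n) q 0<q = refl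
  at _ (nonMultiple 7∤n) rewrite atDiv7-∤ f 7∤n | atDiv7-∤ (λ n → c * f n) 7∤n = *-zeroʳ c

∑-7* : ∀ n f → (∀ i → ¬ 7 ∣ i → f i ≡ 0) → (∀ i → 7 * n < i → f i ≡ 0) →
       ∑ (7 * n) f ≡ ∑[ i ≤ n ] f (7 * i)
∑-7* n f f≡0-∤ f≡0-> = begin
  ∑ (7 * n) f
    ≡⟨ ∑-cong (7 * n) supported ⟩
  ∑[ i ≤ 7 * n ] (⟦ 7 ∣? i ⟧ * f i)
    ≡⟨ ∑-multiples (7 * n) 7 f f≡0-> ⟩
  ∑[ i ≤ 7 * n ] f (7 * i)
    ≡⟨ ∑-extend (m≤n*m n 7) (λ i n<i → f≡0-> (7 * i) (*-monoʳ-< 7 n<i)) ⟩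
  ∑[ i ≤ n ] f (7 * i) ∎
  where
  open ≡-Reasoning
  supported : ∀ i → f i ≡ ⟦ 7 ∣? i ⟧ * f i
  supported i with 7 ∣? i
  ... | yes 7∣i = trans (sym (+-identityʳ (f i))) (cong (_* f i) (sym (⟦⟧-true (7 ∣? i) 7∣i)))
  ... | no 7∤i = trans (f≡0-∤ i 7∤i) (cong (_* f i) (sym (⟦⟧-false (7 ∣? i) 7∤i)))

∑∑-7* : ∀ n (f : ℕ → ℕ → ℕ) → (∀ i j → ¬ (7 ∣ i × 7 ∣ j) → f i j ≡ 0) →
        (∀ i j → 7 * n < i → f i j ≡ 0) → (∀ i j → 7 * n < j → f i j ≡ 0) →
        ∑[ i ≤ 7 * n ] ∑[ j ≤ 7 * n ] f i j ≡ ∑[ i ≤ n ] ∑[ j ≤ n ] f (7 * i) (7 * j)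
∑∑-7* n f f≡0-∤ f≡0-i f≡0-j = trans
  (∑-7* n _ (λ i 7∤i → ∑-0 (7 * n) λ j _ _ → f≡0-∤ i j (7∤i ∘ proj₁))
            (λ i 7n<i → ∑-0 (7 * n) λ j _ _ → f≡0-i i j 7n<i))
  (∑-cong n λ i → ∑-7* n (f (7 * i)) (λ j 7∤j → f≡0-∤ (7 * i) j (7∤j ∘ proj₂)) (f≡0-j (7 * i)))

-- Descent at 7 for the quadratic forms

⟦7*⟧ : ∀ v n → ⟦ 7 * v ≟ 7 * n ⟧ ≡ ⟦ v ≟ n ⟧
⟦7*⟧ v n = ⟦⟧-cong (7 * v ≟ 7 * n) (v ≟ n) (*-cancelˡ-≡ v n 7) (cong (7 *_))

⟦49*⟧ : ∀ v n → ⟦ 49 * v ≟ 7 * n ⟧ ≡ ⟦ 7 * v ≟ n ⟧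
⟦49*⟧ v n = trans (⟦⟧-≡ (*-assoc 7 7 v)) (⟦7*⟧ (7 * v) n)

⟦7*⟧-∣ : ∀ v q → ⟦ 7 * v ≟ q * 7 ⟧ ≡ ⟦ v ≟ q ⟧
⟦7*⟧-∣ v q = trans (cong (λ z → ⟦ 7 * v ≟ z ⟧) (*-comm q 7)) (⟦7*⟧ v q)

⟦7*⟧-∤ : ∀ v → ¬ 7 ∣ n → ⟦ 7 * v ≟ n ⟧ ≡ 0
⟦7*⟧-∤ {n} v 7∤n = ⟦⟧-false (7 * v ≟ n) λ { refl → 7∤n (m∣m*n v) }

%7≈ : ∀ a → a ≈ a % 7 [mod 7 ]
%7≈ a = congruent {i = 0} {j = a / 7} (trans (+-identityʳ a)
  (trans (m≡m%n+[m/n]*n a 7) (cong (a % 7 +_) (*-comm (a / 7) 7))))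

≈-sq : a ≈ b [mod m ] → a * a ≈ b * b [mod m ]
≈-sq {a} {b} p = ≈-trans (≈-* a p) (≈-*ʳ b p)

-- Stated on residues, so that 49 cases decide it. It holds for `c = 1` and `c = 2` because -2 and
-- -1 are not squares modulo 7.
AnisotropicMod7 : ℕ → Set
AnisotropicMod7 c = ∀ (i j : Fin 7) → (c * (toℕ i * toℕ i) + 2 * (toℕ j * toℕ j)) % 7 ≡ 0 → toℕ i ≡ 0 × toℕ j ≡ 0

anisotropicMod7? : ∀ c → Dec (AnisotropicMod7 c)
anisotropicMod7? c = all? λ i → all? λ j →
  ((c * (toℕ i * toℕ i) + 2 * (toℕ j * toℕ j)) % 7 ≟ 0) →-dec ((toℕ i ≟ 0) ×-dec (toℕ j ≟ 0))

anisotropic : ∀ c → AnisotropicMod7 c → ∀ a b → 7 ∣ c * (a * a) + 2 * (b * b) → 7 ∣ a × 7 ∣ b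
anisotropic c aniso a b 7∣ab =
  m%n≡0⇒n∣m a 7 (trans (sym i≡) (proj₁ both)) ,
  m%n≡0⇒n∣m b 7 (trans (sym j≡) (proj₂ both))
  where
  i = fromℕ< (m%n<n a 7)
  j = fromℕ< (m%n<n b 7)
  i≡ : toℕ i ≡ a % 7
  i≡ = toℕ-fromℕ< (m%n<n a 7)
  j≡ : toℕ j ≡ b % 7
  j≡ = toℕ-fromℕ< (m%n<n b 7)
  a≈i : a ≈ toℕ i [mod 7 ]
  a≈i = ≈-trans (%7≈ a) (≡⇒≈ (sym i≡))
  b≈j : b ≈ toℕ j [mod 7 ]
  b≈j = ≈-trans (%7≈ b) (≡⇒≈ (sym j≡))
  both = aniso i j (trans
    (sym (≈⇒% (≈-+ (≈-* c (≈-sq a≈i)) (≈-* 2 (≈-sq b≈j)))))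
    (n∣m⇒m%n≡0 _ 7 7∣ab))

-- Anisotropy forces 7 to divide both variables of a representation of `7 * n`. Dividing them by 7
-- turns the equation into `7 * form a b = n`, which is unsolvable unless 7 divides `n` and
-- otherwise represents `n / 7`.
r-7* : ∀ c → .{{NonZero c}} → AnisotropicMod7 c → ∀ n → 0 < n → r c (7 * n) ≡ atDiv7 (r c) n
r-7* c aniso n 0<n = trans (∑∑-7* n _ f≡0-∤ f≡0-i f≡0-j)
  (trans (∑-cong n λ a → ∑-cong n λ b → trans (⟦⟧-≡ (homogeneous c a b)) (⟦49*⟧ (form a b) n))
         (descend n (div7View n 0<n)))
  where
  form : ℕ → ℕ → ℕ
  form a b = c * (a * a) + 2 * (b * b)
  i≤form : ∀ a b → a ≤ form a b
  i≤form zero    b = z≤n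
  i≤form a@(suc _) b = ≤-trans (m≤m*n a a) (≤-trans (m≤n*m (a * a) c) (m≤m+n _ _))
  j≤form : ∀ a b → b ≤ form a b
  j≤form a zero    = z≤n
  j≤form a b@(suc _) = ≤-trans (m≤m*n b b) (≤-trans (m≤n*m (b * b) 2) (m≤n+m _ _))
  homogeneous : ∀ c a b → c * ((7 * a) * (7 * a)) + 2 * ((7 * b) * (7 * b)) ≡ 49 * (c * (a * a) + 2 * (b * b))
  homogeneous = solve-∀
  f≡0-∤ : ∀ a b → ¬ (7 ∣ a × 7 ∣ b) → ⟦ form a b ≟ 7 * n ⟧ ≡ 0
  f≡0-∤ a b ¬both = ⟦⟧-false (form a b ≟ 7 * n) λ eq →
    ¬both (anisotropic c aniso a b (subst (7 ∣_) (sym eq) (m∣m*n n)))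
  f≡0-i : ∀ a b → 7 * n < a → ⟦ form a b ≟ 7 * n ⟧ ≡ 0
  f≡0-i a b 7n<a = ⟦⟧-> (≤-trans 7n<a (i≤form a b))
  f≡0-j : ∀ a b → 7 * n < b → ⟦ form a b ≟ 7 * n ⟧ ≡ 0
  f≡0-j a b 7n<b = ⟦⟧-> (≤-trans 7n<b (j≤form a b))
  descend : ∀ n → Div7View n → ∑[ a ≤ n ] ∑[ b ≤ n ] ⟦ 7 * form a b ≟ n ⟧ ≡ atDiv7 (r c) n
  descend _ (multiple q 0<q) rewrite atDiv7-∣ (r c) q 0<q = trans
    (∑-cong (q * 7) λ a → ∑-cong (q * 7) λ b → ⟦7*⟧-∣ (form a b) q)
    -- The sums still run up to `q * 7`; representations of `q` have both variables at most `q`.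
    (trans (∑-extend (m≤m*n q 7) λ a q<a → ∑-0 (q * 7) λ b _ _ → ⟦⟧-> (≤-trans q<a (i≤form a b)))
           (∑-cong q λ a → ∑-extend (m≤m*n q 7) λ b q<b → ⟦⟧-> (≤-trans q<b (j≤form a b))))
  descend n (nonMultiple 7∤n) rewrite atDiv7-∤ (r c) 7∤n =
    ∑-0 n λ a _ _ → ∑-0 n λ b _ _ → ⟦7*⟧-∤ (form a b) 7∤n

r-periodic : ∀ c → .{{NonZero c}} → AnisotropicMod7 c → Periodic m (r c)
r-periodic c aniso = periodic λ n 0<n → ≡⇒≈ (r-7* c aniso n 0<n)

prime-7 : Prime 7
prime-7 = from-yes (prime? 7)

-- The descent of `r-7*` in one variable: since 7 is prime and does not divide `c`, it divides `a`.
s-7* : ∀ c → .{{NonZero c}} → ¬ 7 ∣ c → ∀ n → 0 < n → s c (7 * n) ≡ atDiv7 (s c) n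
s-7* c 7∤c n 0<n = trans (∑-7* n _ f≡0-∤ (λ a 7n<a → ⟦⟧-> (≤-trans 7n<a (i≤form a))))
  (trans (∑-cong n λ a → trans (⟦⟧-≡ (homogeneous c a)) (⟦49*⟧ (form a) n))
         (descend n (div7View n 0<n)))
  where
  form : ℕ → ℕ
  form a = c * (a * a)
  i≤form : ∀ a → a ≤ form a
  i≤form zero      = z≤n
  i≤form a@(suc _) = ≤-trans (m≤m*n a a) (m≤n*m (a * a) c)
  homogeneous : ∀ c a → c * ((7 * a) * (7 * a)) ≡ 49 * (c * (a * a))
  homogeneous = solve-∀
  f≡0-∤ : ∀ a → ¬ 7 ∣ a → ⟦ form a ≟ 7 * n ⟧ ≡ 0
  f≡0-∤ a 7∤a = ⟦⟧-false (form a ≟ 7 * n) λ eq →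
    [ 7∤c , [ 7∤a , 7∤a ]′ ∘ euclidsLemma a a prime-7 ]′
      (euclidsLemma c (a * a) prime-7 (subst (7 ∣_) (sym eq) (m∣m*n n)))
  descend : ∀ n → Div7View n → ∑[ a ≤ n ] ⟦ 7 * form a ≟ n ⟧ ≡ atDiv7 (s c) n
  descend _ (multiple q 0<q) rewrite atDiv7-∣ (s c) q 0<q = trans
    (∑-cong (q * 7) λ a → ⟦7*⟧-∣ (form a) q)
    (∑-extend (m≤m*n q 7) λ a q<a → ⟦⟧-> (≤-trans q<a (i≤form a)))
  descend n (nonMultiple 7∤n) rewrite atDiv7-∤ (s c) 7∤n = ∑-0 n λ a _ _ → ⟦7*⟧-∤ (form a) 7∤n

s-periodic : ∀ c → .{{NonZero c}} → ¬ 7 ∣ c → Periodic m (s c)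
s-periodic c 7∤c = periodic λ n 0<n → ≡⇒≈ (s-7* c 7∤c n 0<n)

-- The sum of divisors, as a sum over factorisations

σ : ℕ → ℕ
σ N = ∑[ a ≤ N ] ∑[ x ≤ N ] (x * ⟦ a * x ≟ N ⟧)

-- Factors never exceed their positive product, so a larger box changes nothing. This lets the
-- divisor sums of `n`, `n / 7` and `7 * n` share one box.
σ-box : ∀ {B} n → n ≤ B → ∑[ a ≤ B ] ∑[ x ≤ B ] (x * ⟦ a * x ≟ n ⟧) ≡ σ n
σ-box {B} n n≤B = trans
  (∑-extend n≤B λ a n<a → ∑-0 B λ { x@(suc _) _ _ →
     trans (cong (x *_) (⟦⟧-> (≤-trans n<a (m≤m*n a x)))) (*-zeroʳ x) })
  (∑-cong-≤ n λ { a@(suc _) _ _ → ∑-extend n≤B λ x n<x →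
     trans (cong (x *_) (⟦⟧-> (≤-trans n<x (m≤n*m x a)))) (*-zeroʳ x) })

-- The Hecke relation at 7, by inclusion and exclusion. In a factorisation `a * x` of `7 * n`, the
-- prime 7 divides `a` or `x`. The cases `7 ∣ a` add up to `σ n`; the cases `7 ∣ x` to `7 * σ n`,
-- since the weight `x` gains a factor 7; and both at once to 7 times the divisor sum of `n / 7`.
σ-Hecke : ∀ n → 0 < n → σ (7 * n) + 7 * atDiv7 σ n ≡ σ n + 7 * σ n
σ-Hecke n 0<n = begin
  σ M + 7 * atDiv7 σ n
    ≡⟨ cong (σ M +_) both ⟨
  σ M + ∑[ a ≤ M ] ∑[ x ≤ M ] (⟦ 7 ∣? a ⟧ * (⟦ 7 ∣? x ⟧ * w a x))
    ≡⟨ ∑∑-+ w _ ⟨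
  ∑[ a ≤ M ] ∑[ x ≤ M ] (w a x + ⟦ 7 ∣? a ⟧ * (⟦ 7 ∣? x ⟧ * w a x))
    ≡⟨ ∑-cong M (λ a → ∑-cong M (inclusion-exclusion a)) ⟩
  ∑[ a ≤ M ] ∑[ x ≤ M ] (⟦ 7 ∣? a ⟧ * w a x + ⟦ 7 ∣? x ⟧ * w a x)
    ≡⟨ ∑∑-+ _ _ ⟩
  ∑[ a ≤ M ] ∑[ x ≤ M ] (⟦ 7 ∣? a ⟧ * w a x) + ∑[ a ≤ M ] ∑[ x ≤ M ] (⟦ 7 ∣? x ⟧ * w a x)
    ≡⟨ cong₂ _+_ left right ⟩
  σ n + 7 * σ n ∎
  where
  open ≡-Reasoning
  M = 7 * n
  n≤M : n ≤ M
  n≤M = m≤n*m n 7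
  w : ℕ → ℕ → ℕ
  w a x = x * ⟦ a * x ≟ M ⟧

  ∑∑-+ : ∀ (g h : ℕ → ℕ → ℕ) → ∑[ a ≤ M ] ∑[ x ≤ M ] (g a x + h a x) ≡ ∑[ a ≤ M ] ∑[ x ≤ M ] g a x + ∑[ a ≤ M ] ∑[ x ≤ M ] h a x
  ∑∑-+ g h = trans (∑-cong M λ a → ∑-+ M (g a) (h a)) (∑-+ M _ _)

  ∑∑-* : ∀ c (g : ℕ → ℕ → ℕ) → ∑[ a ≤ M ] ∑[ x ≤ M ] (c * g a x) ≡ c * (∑[ a ≤ M ] ∑[ x ≤ M ] g a x)
  ∑∑-* c g = trans (∑-cong M λ a → ∑-* M c (g a)) (∑-* M c _)

  w≡0-a : ∀ a x → 0 < x → M < a → w a x ≡ 0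
  w≡0-a a x@(suc _) _ M<a = trans (cong (x *_) (⟦⟧-> (≤-trans M<a (m≤m*n a x)))) (*-zeroʳ x)

  w≡0-x : ∀ a x → 0 < a → M < x → w a x ≡ 0
  w≡0-x a@(suc _) x _ M<x = trans (cong (x *_) (⟦⟧-> (≤-trans M<x (m≤n*m x a)))) (*-zeroʳ x)

  inclusion-exclusion : ∀ a x → w a x + ⟦ 7 ∣? a ⟧ * (⟦ 7 ∣? x ⟧ * w a x) ≡ ⟦ 7 ∣? a ⟧ * w a x + ⟦ 7 ∣? x ⟧ * w a x
  inclusion-exclusion a x with a * x ≟ M
  ... | no ax≢M rewrite ⟦⟧-false (a * x ≟ M) ax≢M | *-zeroʳ x | *-zeroʳ ⟦ 7 ∣? a ⟧ | *-zeroʳ ⟦ 7 ∣? x ⟧ = *-zeroʳ ⟦ 7 ∣? a ⟧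
  ... | yes ax≡M with euclidsLemma a x prime-7 (subst (7 ∣_) (sym ax≡M) (m∣m*n n))
  ...   | inj₁ 7∣a rewrite ⟦⟧-true (7 ∣? a) 7∣a = lemma (w a x) ⟦ 7 ∣? x ⟧
    where
    lemma : ∀ u v → u + 1 * (v * u) ≡ 1 * u + v * u
    lemma = solve-∀
  ...   | inj₂ 7∣x rewrite ⟦⟧-true (7 ∣? x) 7∣x = lemma (w a x) ⟦ 7 ∣? a ⟧
    where
    lemma : ∀ u v → u + v * (1 * u) ≡ v * u + 1 * u
    lemma = solve-∀

  left : ∑[ a ≤ M ] ∑[ x ≤ M ] (⟦ 7 ∣? a ⟧ * w a x) ≡ σ n
  left = begin
    ∑[ a ≤ M ] ∑[ x ≤ M ] (⟦ 7 ∣? a ⟧ * w a x)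
      ≡⟨ ∑-cong M (λ a → ∑-* M ⟦ 7 ∣? a ⟧ (w a)) ⟩
    ∑[ a ≤ M ] (⟦ 7 ∣? a ⟧ * ∑ M (w a))
      ≡⟨ ∑-multiples M 7 _ (λ a M<a → ∑-0 M λ x 0<x _ → w≡0-a a x 0<x M<a) ⟩
    ∑[ a ≤ M ] ∑[ x ≤ M ] (x * ⟦ (7 * a) * x ≟ M ⟧)
      ≡⟨ ∑-cong M (λ a → ∑-cong M λ x → cong (x *_) (trans (⟦⟧-≡ (*-assoc 7 a x)) (⟦7*⟧ (a * x) n))) ⟩
    ∑[ a ≤ M ] ∑[ x ≤ M ] (x * ⟦ a * x ≟ n ⟧)
      ≡⟨ σ-box n n≤M ⟩
    σ n ∎

  ∑-7∣x : ∀ a → 0 < a → ∑[ x ≤ M ] (⟦ 7 ∣? x ⟧ * w a x) ≡ ∑[ x ≤ M ] (7 * (x * ⟦ a * x ≟ n ⟧))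
  ∑-7∣x a 0<a = trans (∑-multiples M 7 (w a) (λ x → w≡0-x a x 0<a))
    (∑-cong M λ x → trans (cong ((7 * x) *_) (trans (⟦⟧-≡ (comm a x)) (⟦7*⟧ (a * x) n))) (*-assoc 7 x _))
    where
    comm : ∀ a x → a * (7 * x) ≡ 7 * (a * x)
    comm = solve-∀

  right : ∑[ a ≤ M ] ∑[ x ≤ M ] (⟦ 7 ∣? x ⟧ * w a x) ≡ 7 * σ n
  right = begin
    ∑[ a ≤ M ] ∑[ x ≤ M ] (⟦ 7 ∣? x ⟧ * w a x)
      ≡⟨ ∑-cong-≤ M (λ a 0<a _ → ∑-7∣x a 0<a) ⟩
    ∑[ a ≤ M ] ∑[ x ≤ M ] (7 * (x * ⟦ a * x ≟ n ⟧))
      ≡⟨ ∑∑-* 7 _ ⟩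
    7 * (∑[ a ≤ M ] ∑[ x ≤ M ] (x * ⟦ a * x ≟ n ⟧))
      ≡⟨ cong (7 *_) (σ-box n n≤M) ⟩
    7 * σ n ∎

  descend : ∀ n → Div7View n → n ≤ M → ∑[ a ≤ M ] ∑[ x ≤ M ] (x * ⟦ 7 * (a * x) ≟ n ⟧) ≡ atDiv7 σ n
  descend _ (multiple q 0<q) q7≤M rewrite atDiv7-∣ σ q 0<q = trans
    (∑-cong M λ a → ∑-cong M λ x → cong (x *_) (⟦7*⟧-∣ (a * x) q))
    (σ-box q (≤-trans (m≤m*n q 7) q7≤M))
  descend _ (nonMultiple 7∤n) _ rewrite atDiv7-∤ σ 7∤n =
    ∑-0 M λ a _ _ → ∑-0 M λ x _ _ → trans (cong (x *_) (⟦7*⟧-∤ (a * x) 7∤n)) (*-zeroʳ x)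

  both : ∑[ a ≤ M ] ∑[ x ≤ M ] (⟦ 7 ∣? a ⟧ * (⟦ 7 ∣? x ⟧ * w a x)) ≡ 7 * atDiv7 σ n
  both = begin
    ∑[ a ≤ M ] ∑[ x ≤ M ] (⟦ 7 ∣? a ⟧ * (⟦ 7 ∣? x ⟧ * w a x))
      ≡⟨ ∑-cong-≤ M (λ a 0<a _ → trans (∑-* M ⟦ 7 ∣? a ⟧ _) (cong (⟦ 7 ∣? a ⟧ *_) (∑-7∣x a 0<a))) ⟩
    ∑[ a ≤ M ] (⟦ 7 ∣? a ⟧ * (∑[ x ≤ M ] (7 * (x * ⟦ a * x ≟ n ⟧))))
      ≡⟨ ∑-multiples M 7 _ (λ a M<a → ∑-0 M λ { x@(suc _) _ _ → cong (7 *_)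
           (trans (cong (x *_) (⟦⟧-> (≤-trans (≤-<-trans n≤M M<a) (m≤m*n a x)))) (*-zeroʳ x)) }) ⟩
    ∑[ a ≤ M ] ∑[ x ≤ M ] (7 * (x * ⟦ (7 * a) * x ≟ n ⟧))
      ≡⟨ ∑-cong M (λ a → ∑-cong M λ x → cong (λ z → 7 * (x * z)) (⟦⟧-≡ (*-assoc 7 a x))) ⟩
    ∑[ a ≤ M ] ∑[ x ≤ M ] (7 * (x * ⟦ 7 * (a * x) ≟ n ⟧))
      ≡⟨ ∑∑-* 7 _ ⟩
    7 * (∑[ a ≤ M ] ∑[ x ≤ M ] (x * ⟦ 7 * (a * x) ≟ n ⟧))
      ≡⟨ cong (7 *_) (descend n (div7View n 0<n) n≤M) ⟩
    7 * atDiv7 σ n ∎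

-- Modulo 4 the coefficient 7 in `σ-Hecke` is -1 and the total on its right is `8 * σ n`, hence 0.
-- Adding `t` to both sides of that relation produces the two witnesses.
σ-periodic : Periodic 4 σ
σ-periodic = periodic λ n 0<n → let t = atDiv7 σ n in congruent {i = 2 * atDiv7 σ n} {j = 2 * σ n} (begin
  σ (7 * n) + 4 * (2 * t)   ≡⟨ lemma₁ (σ (7 * n)) t ⟩
  σ (7 * n) + 7 * t + t     ≡⟨ cong (_+ t) (σ-Hecke n 0<n) ⟩
  σ n + 7 * σ n + t         ≡⟨ lemma₂ (σ n) t ⟩
  t + 4 * (2 * σ n)         ∎)
  where
  open ≡-Reasoning
  lemma₁ : ∀ u t → u + 4 * (2 * t) ≡ u + 7 * t + t
  lemma₁ = solve-∀
  lemma₂ : ∀ u t → u + 7 * u + t ≡ t + 4 * (2 * u)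
  lemma₂ = solve-∀

-- Power series

infixl 7 _⋆_
-- The Cauchy product by recursion on the coefficient index, so that the ring laws follow by
-- induction; `⊗≗⋆` identifies it with the list version.
_⋆_ : Series → Series → Series
(f ⋆ g) zero    = f 0 * g 0
(f ⋆ g) (suc N) = f 0 * g (suc N) + ((f ∘ suc) ⋆ g) N

Σℕ-upTo : ∀ N f → Σℕ (map (λ i → f (suc i)) (upTo N)) ≡ ∑ N f
Σℕ-upTo N f = trans (cong Σℕ (map-upTo (f ∘ suc) N)) (go N f)
  where
  go : ∀ N f → Σℕ (applyUpTo (f ∘ suc) N) ≡ ∑ N f
  go zero    f = refl
  go (suc N) f = cong (f 1 +_) (go N (f ∘ suc))

⊗≗⋆ : ∀ f g → f ⊗ g ≗ f ⋆ g
⊗≗⋆ f g N = trans (cong Σℕ (map-upTo (λ k → f k * g (N ∸ k)) (suc N))) (go f N)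
  where
  go : ∀ f N → Σℕ (applyUpTo (λ k → f k * g (N ∸ k)) (suc N)) ≡ (f ⋆ g) N
  go f zero    = +-identityʳ _
  go f (suc N) = cong (f 0 * g (suc N) +_) (go (f ∘ suc) N)

-- Only coefficients up to `N` enter the product, so expansions that are valid merely up to `N`,
-- such as `tail≡∑`, may be substituted.
⋆-lift : (_∼_ : ℕ → ℕ → Set) →
         (∀ {a b c d} → a ∼ b → c ∼ d → (a + c) ∼ (b + d)) →
         (∀ {a b c d} → a ∼ b → c ∼ d → (a * c) ∼ (b * d)) →
         ∀ N → (∀ i → i ≤ N → f i ∼ f′ i) → (∀ i → i ≤ N → g i ∼ g′ i) → (f ⋆ g) N ∼ (f′ ⋆ g′) N
⋆-lift _∼_ +-mono *-mono zero    f∼f′ g∼g′ = *-mono (f∼f′ 0 z≤n) (g∼g′ 0 z≤n)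
⋆-lift _∼_ +-mono *-mono (suc N) f∼f′ g∼g′ = +-mono (*-mono (f∼f′ 0 z≤n) (g∼g′ (suc N) ≤-refl))
  (⋆-lift _∼_ +-mono *-mono N (λ i i≤N → f∼f′ (suc i) (s≤s i≤N)) (λ i i≤N → g∼g′ i (m≤n⇒m≤1+n i≤N)))

⋆-cong-≤ : ∀ N → (∀ i → i ≤ N → f i ≡ f′ i) → (∀ i → i ≤ N → g i ≡ g′ i) → (f ⋆ g) N ≡ (f′ ⋆ g′) N
⋆-cong-≤ = ⋆-lift _≡_ (cong₂ _+_) (cong₂ _*_)

⋆-cong : f ≗ f′ → g ≗ g′ → f ⋆ g ≗ f′ ⋆ g′
⋆-cong f≗f′ g≗g′ N = ⋆-cong-≤ N (λ i _ → f≗f′ i) (λ i _ → g≗g′ i)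

⋆-≈ : (∀ i → f i ≈ f′ i [mod m ]) → (∀ i → g i ≈ g′ i [mod m ]) → ∀ N → (f ⋆ g) N ≈ (f′ ⋆ g′) N [mod m ]
⋆-≈ {m = m} f≈f′ g≈g′ N = ⋆-lift _≈_[mod m ] ≈-+ (λ {a} {b} {c} {d} p q → ≈-trans (≈-* a q) (≈-*ʳ d p))
  N (λ i _ → f≈f′ i) (λ i _ → g≈g′ i)

⋆-distribʳ : ∀ f g h N → ((λ i → f i + g i) ⋆ h) N ≡ (f ⋆ h) N + (g ⋆ h) N
⋆-distribʳ f g h zero    = *-distribʳ-+ (h 0) (f 0) (g 0)
⋆-distribʳ f g h (suc N) rewrite ⋆-distribʳ (f ∘ suc) (g ∘ suc) h N = lemma (f 0) (g 0) (h (suc N)) _ _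
  where
  lemma : ∀ p q r s t → (p + q) * r + (s + t) ≡ p * r + s + (q * r + t)
  lemma = solve-∀

⋆-scaleˡ : ∀ c f g N → ((λ i → c * f i) ⋆ g) N ≡ c * (f ⋆ g) N
⋆-scaleˡ c f g zero    = *-assoc c (f 0) (g 0)
⋆-scaleˡ c f g (suc N) rewrite ⋆-scaleˡ c (f ∘ suc) g N = lemma c (f 0) (g (suc N)) _
  where
  lemma : ∀ c p q r → c * p * q + c * r ≡ c * (p * q + r)
  lemma = solve-∀

-- The definition splits off the first coefficient of `f`; splitting off the last one is its mirror
-- image and yields commutativity.
⋆-suc : ∀ f g N → (f ⋆ g) (suc N) ≡ (f ⋆ (g ∘ suc)) N + f (suc N) * g 0
⋆-suc f g zero    = refl
⋆-suc f g (suc N) rewrite ⋆-suc (f ∘ suc) g N = sym (+-assoc (f 0 * g (suc (suc N))) _ _)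

⋆-comm : ∀ f g → f ⋆ g ≗ g ⋆ f
⋆-comm f g zero    = *-comm (f 0) (g 0)
⋆-comm f g (suc N) = begin
  (f ⋆ g) (suc N)                          ≡⟨ ⋆-suc f g N ⟩
  (f ⋆ (g ∘ suc)) N + f (suc N) * g 0      ≡⟨ cong₂ _+_ (⋆-comm f (g ∘ suc) N) (*-comm (f (suc N)) (g 0)) ⟩
  ((g ∘ suc) ⋆ f) N + g 0 * f (suc N)      ≡⟨ +-comm _ (g 0 * f (suc N)) ⟩
  (g ⋆ f) (suc N)                          ∎
  where open ≡-Reasoning

⋆-assoc : ∀ f g h → (f ⋆ g) ⋆ h ≗ f ⋆ (g ⋆ h)
⋆-assoc f g h zero    = *-assoc (f 0) (g 0) (h 0)
⋆-assoc f g h (suc N) = begin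
  f 0 * g 0 * h (suc N) + ((λ i → f 0 * g (suc i) + ((f ∘ suc) ⋆ g) i) ⋆ h) N
    ≡⟨ cong (f 0 * g 0 * h (suc N) +_) (⋆-distribʳ _ _ h N) ⟩
  f 0 * g 0 * h (suc N) + (((λ i → f 0 * g (suc i)) ⋆ h) N + (((f ∘ suc) ⋆ g) ⋆ h) N)
    ≡⟨ cong (f 0 * g 0 * h (suc N) +_) (cong₂ _+_ (⋆-scaleˡ (f 0) (g ∘ suc) h N) (⋆-assoc (f ∘ suc) g h N)) ⟩
  f 0 * g 0 * h (suc N) + (f 0 * ((g ∘ suc) ⋆ h) N + ((f ∘ suc) ⋆ (g ⋆ h)) N)
    ≡⟨ lemma (f 0) (g 0) (h (suc N)) _ _ ⟩
  f 0 * (g 0 * h (suc N) + ((g ∘ suc) ⋆ h) N) + ((f ∘ suc) ⋆ (g ⋆ h)) N ∎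
  where
  open ≡-Reasoning
  lemma : ∀ p q r s t → p * q * r + (p * s + t) ≡ p * (q * r + s) + t
  lemma = solve-∀

⋆-commutativeSemigroup : CommutativeSemigroup _ _
⋆-commutativeSemigroup = record
  { Carrier = Series ; _≈_ = _≗_ ; _∙_ = _⋆_
  ; isCommutativeSemigroup = record
    { isSemigroup = record
      { isMagma = record { isEquivalence = Setoid.isEquivalence (ℕ →-setoid ℕ) ; ∙-cong = ⋆-cong }
      ; assoc = ⋆-assoc }
    ; comm = ⋆-comm } }

open CommutativeSemigroupProperties ⋆-commutativeSemigroup using (interchange)
module ≗-Reasoning = SetoidReasoning (ℕ →-setoid ℕ)

⋆-zeroˡ : ∀ g N → ((λ _ → 0) ⋆ g) N ≡ 0
⋆-zeroˡ g zero    = refl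
⋆-zeroˡ g (suc N) = ⋆-zeroˡ g N

⋆-∑ˡ : ∀ M (F : ℕ → Series) g N → ((λ i → ∑[ x ≤ M ] F x i) ⋆ g) N ≡ ∑[ x ≤ M ] (F x ⋆ g) N
⋆-∑ˡ zero    F g N = ⋆-zeroˡ g N
⋆-∑ˡ (suc M) F g N = trans (⋆-distribʳ (F 1) _ g N) (cong ((F 1 ⋆ g) N +_) (⋆-∑ˡ M (F ∘ suc) g N))

⋆-∑ʳ : ∀ M g (F : ℕ → Series) N → (g ⋆ (λ i → ∑[ x ≤ M ] F x i)) N ≡ ∑[ x ≤ M ] (g ⋆ F x) N
⋆-∑ʳ M g F N = trans (⋆-comm g _ N) (trans (⋆-∑ˡ M F g N) (∑-cong M λ x → ⋆-comm (F x) g N))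

⋆-distribˡ : ∀ f g h N → (f ⋆ (λ i → g i + h i)) N ≡ (f ⋆ g) N + (f ⋆ h) N
⋆-distribˡ f g h N = trans (⋆-comm f _ N) (trans (⋆-distribʳ g h f N) (cong₂ _+_ (⋆-comm g f N) (⋆-comm h f N)))

⋆-scaleʳ : ∀ c f g N → (f ⋆ (λ i → c * g i)) N ≡ c * (f ⋆ g) N
⋆-scaleʳ c f g N = trans (⋆-comm f _ N) (trans (⋆-scaleˡ c g f N) (cong (c *_) (⋆-comm g f N)))

-- Monomials, geometric series and their products

δ : ℕ → Series
δ m N = ⟦ m ≟ N ⟧

δ-sym : ∀ m N → ⟦ N ≟ m ⟧ ≡ δ m N
δ-sym m N = ⟦⟧-cong (N ≟ m) (m ≟ N) sym sym

δ0-⋆ : ∀ f → δ 0 ⋆ f ≗ f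
δ0-⋆ f zero    = +-identityʳ (f 0)
δ0-⋆ f (suc N) = trans (cong₂ _+_ (+-identityʳ (f (suc N))) (⋆-zeroˡ f N)) (+-identityʳ _)

⋆-identityˡ : ∀ f → one ⋆ f ≗ f
⋆-identityˡ f N = trans (⋆-cong (δ-sym 0) (λ _ → refl) N) (δ0-⋆ f N)

⋆-identityʳ : ∀ f → f ⋆ one ≗ f
⋆-identityʳ f N = trans (⋆-comm f one N) (⋆-identityˡ f N)

δ-⋆-δ : ∀ m k N → (δ m ⋆ δ k) N ≡ ⟦ m + k ≟ N ⟧
δ-⋆-δ zero    k N       = δ0-⋆ (δ k) N
δ-⋆-δ (suc m) k zero    = refl
δ-⋆-δ (suc m) k (suc N) = δ-⋆-δ m k N

δ-⋆-≤ : ∀ m f t → (δ m ⋆ f) (m + t) ≡ f t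
δ-⋆-≤ zero    f t = δ0-⋆ f t
δ-⋆-≤ (suc m) f t = δ-⋆-≤ m f t

δ-⋆-> : ∀ m f → N < m → (δ m ⋆ f) N ≡ 0
δ-⋆-> {zero}  (suc m) f N<m       = refl
δ-⋆-> {suc N} (suc m) f (s≤s N<m) = δ-⋆-> m f N<m

shift-⋆ : ∀ n f N → shift n f N ≡ (δ n ⋆ f) N
shift-⋆ n f N with n ≤? N
... | yes n≤N rewrite dec-true (n ≤? N) n≤N =
      sym (subst (λ z → (δ n ⋆ f) z ≡ f (N ∸ n)) (m+[n∸m]≡n n≤N) (δ-⋆-≤ n f (N ∸ n)))
... | no n≰N rewrite dec-false (n ≤? N) n≰N = sym (δ-⋆-> n f (≰⇒> n≰N))

-- q^k / (1 - q^k)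
tail : ℕ → Series
tail k zero    = 0
tail k (suc N) = geom k (suc N)

geom≗1+tail : ∀ k → geom k ≗ λ N → one N + tail k N
geom≗1+tail k zero    = ⟦⟧-true (k ∣? 0) (k ∣0)
geom≗1+tail k (suc N) = refl

-- For `k ≤ N`, `k` divides `N ∸ k` exactly when it divides `N`; for `0 < N < k` it does not divide
-- `N`. The constant term is 0 on both sides.
δ-⋆-geom : ∀ k .{{_ : NonZero k}} → δ k ⋆ geom k ≗ tail k
δ-⋆-geom (suc k) zero = refl
δ-⋆-geom k N@(suc _) with k ≤? N
... | no k≰N  = trans (δ-⋆-> k (geom k) (≰⇒> k≰N)) (sym (⟦⟧-false (k ∣? N) (λ k∣N → k≰N (∣⇒≤ k∣N))))
... | yes k≤N = trans
      (subst (λ z → (δ k ⋆ geom k) z ≡ geom k (N ∸ k)) (m+[n∸m]≡n k≤N) (δ-⋆-≤ k (geom k) (N ∸ k)))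
      (⟦⟧-cong (k ∣? (N ∸ k)) (k ∣? N)
        (λ k∣N∸k → subst (k ∣_) (m+[n∸m]≡n k≤N) (∣m∣n⇒∣m+n ∣-refl k∣N∸k))
        (λ k∣N → ∣m+n∣m⇒∣n (subst (k ∣_) (sym (m+[n∸m]≡n k≤N)) k∣N) ∣-refl))

tail≡∑ : ∀ k i .{{_ : NonZero k}} → i ≤ N → tail k i ≡ ∑[ y ≤ N ] δ (k * y) i
tail≡∑ {N} (suc k) zero    _   = sym (∑-0 N λ { (suc y) _ _ → refl })
tail≡∑     k       (suc i) i≤N = sym (∑-∣ k (suc i) z<s i≤N)

onePlus-⋆-geom : ∀ k .{{_ : NonZero k}} → onePlus k ⋆ geom k ≗ λ N → one N + 2 * tail k N
onePlus-⋆-geom k N = begin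
  (onePlus k ⋆ geom k) N                       ≡⟨ ⋆-cong (λ i → cong (one i +_) (δ-sym k i)) (λ _ → refl) N ⟩
  ((λ i → one i + δ k i) ⋆ geom k) N           ≡⟨ ⋆-distribʳ one (δ k) (geom k) N ⟩
  (one ⋆ geom k) N + (δ k ⋆ geom k) N          ≡⟨ cong₂ _+_ (trans (⋆-identityˡ (geom k) N) (geom≗1+tail k N)) (δ-⋆-geom k N) ⟩
  one N + tail k N + tail k N                  ≡⟨ lemma (one N) (tail k N) ⟩
  one N + 2 * tail k N                         ∎
  where
  open ≡-Reasoning
  lemma : ∀ u v → u + v + v ≡ u + 2 * v
  lemma = solve-∀

-- The cross term is `4 * (u ⋆ v) N`, so modulo 4 multiplying such series adds their halved tails.
1+2-⋆ : ∀ u v N → ((λ i → one i + 2 * u i) ⋆ (λ i → one i + 2 * v i)) N ≈ one N + 2 * (u N + v N) [mod 4 ]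
1+2-⋆ u v N = congruent {i = 0} {j = (u ⋆ v) N} (begin
  ((λ i → one i + 2 * u i) ⋆ V) N + 4 * 0
    ≡⟨ cong (_+ 4 * 0) (⋆-distribʳ one (λ i → 2 * u i) V N) ⟩
  (one ⋆ V) N + ((λ i → 2 * u i) ⋆ V) N + 4 * 0
    ≡⟨ cong (λ z → z + 4 * 0) (cong₂ _+_ (⋆-identityˡ V N) (trans (⋆-scaleˡ 2 u V N)
         (cong (2 *_) (trans (⋆-distribˡ u one (λ i → 2 * v i) N)
           (cong₂ _+_ (⋆-identityʳ u N) (⋆-scaleʳ 2 u v N)))))) ⟩
  one N + 2 * v N + 2 * (u N + 2 * (u ⋆ v) N) + 4 * 0
    ≡⟨ lemma (one N) (u N) (v N) ((u ⋆ v) N) ⟩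
  one N + 2 * (u N + v N) + 4 * (u ⋆ v) N ∎)
  where
  open ≡-Reasoning
  V : Series
  V i = one i + 2 * v i
  lemma : ∀ o p q r → o + 2 * q + 2 * (p + 2 * r) + 4 * 0 ≡ o + 2 * (p + q) + 4 * r
  lemma = solve-∀

-- `interchange` pairs each factor `onePlus` with the factor `geom` of the same exponent. The first
-- exponent is written `b + d` because the index of `∑` starts at 1.
prodAP≈ : ∀ b d c .{{_ : NonZero d}} N →
  (prodAP onePlus (b + d) d c ⋆ prodAP geom (b + d) d c) N ≈ one N + 2 * (∑[ i ≤ c ] tail (b + d * i) N) [mod 4 ]
prodAP≈ b d zero    N = ≡⇒≈ (trans (⋆-identityˡ one N) (sym (+-identityʳ (one N))))
prodAP≈ b d (suc c) N = begin
  ((onePlus (b + d) ⊗ num) ⋆ (geom (b + d) ⊗ den)) N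
    ≡⟨ ⋆-cong (⊗≗⋆ (onePlus (b + d)) num) (⊗≗⋆ (geom (b + d)) den) N ⟩
  ((onePlus (b + d) ⋆ num) ⋆ (geom (b + d) ⋆ den)) N
    ≡⟨ interchange (onePlus (b + d)) num (geom (b + d)) den N ⟩
  ((onePlus (b + d) ⋆ geom (b + d)) ⋆ (num ⋆ den)) N
    ≈⟨ ⋆-≈ (λ i → ≡⇒≈ (onePlus-⋆-geom (b + d) i)) (prodAP≈ (b + d) d c) N ⟩
  ((λ i → one i + 2 * tail (b + d) i) ⋆ (λ i → one i + 2 * (∑[ j ≤ c ] tail (b + d + d * j) i))) N
    ≈⟨ 1+2-⋆ (tail (b + d)) (λ i → ∑[ j ≤ c ] tail (b + d + d * j) i) N ⟩
  one N + 2 * (tail (b + d) N + ∑[ j ≤ c ] tail (b + d + d * j) N)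
    ≡⟨ cong (λ z → one N + 2 * z) (cong₂ _+_ (cong (λ z → tail (b + z) N) (sym (*-identityʳ d)))
         (∑-cong c λ j → cong (λ z → tail z N) (trans (+-assoc b d (d * j)) (cong (b +_) (sym (*-suc d j)))))) ⟩
  one N + 2 * (∑[ i ≤ suc c ] tail (b + d * i) N) ∎
  where
  open ≈-Reasoning 4
  num = prodAP onePlus (b + d + d) d c
  den = prodAP geom (b + d + d) d c
  instance
    b+d≢0 : NonZero (b + d)
    b+d≢0 = >-nonZero (≤-trans (>-nonZero⁻¹ d) (m≤n+m d b))

-- q^n / (1 - q^n)^2
A : ℕ → Series
A n = δ n ⋆ (geom n ⋆ geom n)

-- There are `s - 1` ordered ways to write `s` as a sum of two positive integers. The extra 1 avoids
-- subtraction and is the contribution of the constant term in `A≡∑`.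
∑-compositions : ∀ s → 0 < s → s ≤ N → 1 + ∑[ x ≤ N ] ∑[ y ≤ N ] ⟦ y + x ≟ s ⟧ ≡ s
∑-compositions {N} s@(suc s′) _ s≤N = cong suc (begin
  ∑[ x ≤ N ] ∑[ y ≤ N ] ⟦ y + x ≟ s ⟧  ≡⟨ ∑-cong N (λ x → ∑-< x s s≤N) ⟩
  ∑[ x ≤ N ] ⟦ x <? s ⟧                ≡⟨ ∑-cong N (λ x → ⟦⟧-cong (x <? s) (x ≤? s′) s≤s⁻¹ s≤s) ⟩
  ∑[ x ≤ N ] ⟦ x ≤? s′ ⟧               ≡⟨ ∑-≤ s′ (≤-trans (n≤1+n s′) s≤N) ⟩
  s′                                   ∎)
  where open ≡-Reasoning

tail-⋆-tail : ∀ n k i .{{_ : NonZero n}} .{{_ : NonZero k}} → i ≤ N →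
  (tail n ⋆ tail k) i ≡ ∑[ x ≤ N ] ∑[ y ≤ N ] ⟦ n * x + k * y ≟ i ⟧
tail-⋆-tail {N} n k i i≤N = begin
  (tail n ⋆ tail k) i
    ≡⟨ ⋆-cong-≤ i (λ j j≤i → tail≡∑ n j (≤-trans j≤i i≤N)) (λ j j≤i → tail≡∑ k j (≤-trans j≤i i≤N)) ⟩
  ((λ j → ∑[ x ≤ N ] δ (n * x) j) ⋆ (λ j → ∑[ y ≤ N ] δ (k * y) j)) i
    ≡⟨ ⋆-∑ˡ N (λ x → δ (n * x)) _ i ⟩
  ∑[ x ≤ N ] (δ (n * x) ⋆ (λ j → ∑[ y ≤ N ] δ (k * y) j)) i
    ≡⟨ ∑-cong N (λ x → trans (⋆-∑ʳ N (δ (n * x)) (λ y → δ (k * y)) i) (∑-cong N λ y → δ-⋆-δ (n * x) (k * y) i)) ⟩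
  ∑[ x ≤ N ] ∑[ y ≤ N ] ⟦ n * x + k * y ≟ i ⟧ ∎
  where open ≡-Reasoning

-- The expansion of q^n / (1 - q^n)^2 as the sum of s q^(ns). The series is written as `tail n`
-- times `1 + tail n`, and monomials are collected by `s = x + y`.
A≡∑ : ∀ n i .{{_ : NonZero n}} → i ≤ N → A n i ≡ ∑[ s ≤ N ] (s * δ (n * s) i)
A≡∑ {N} n i i≤N = begin
  (δ n ⋆ (geom n ⋆ geom n)) i
    ≡⟨ ⋆-assoc (δ n) (geom n) (geom n) i ⟨
  ((δ n ⋆ geom n) ⋆ geom n) i
    ≡⟨ ⋆-cong (δ-⋆-geom n) (geom≗1+tail n) i ⟩
  (tail n ⋆ (λ j → one j + tail n j)) i
    ≡⟨ ⋆-distribˡ (tail n) one (tail n) i ⟩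
  (tail n ⋆ one) i + (tail n ⋆ tail n) i
    ≡⟨ cong₂ _+_ (trans (⋆-identityʳ (tail n) i) (tail≡∑ n i i≤N)) (tail-⋆-tail n n i i≤N) ⟩
  ∑[ s ≤ N ] δ (n * s) i + ∑[ x ≤ N ] ∑[ y ≤ N ] ⟦ n * x + n * y ≟ i ⟧
    ≡⟨ cong (∑[ s ≤ N ] δ (n * s) i +_) (∑-cong-≤ N λ x 0<x _ → ∑-cong N λ y → sym (collect x y 0<x)) ⟩
  ∑[ s ≤ N ] δ (n * s) i + ∑[ x ≤ N ] ∑[ y ≤ N ] ∑[ s ≤ N ] (⟦ y + x ≟ s ⟧ * δ (n * s) i)
    ≡⟨ cong (∑[ s ≤ N ] δ (n * s) i +_) (trans (∑-cong N λ x → ∑-swap N N _) (∑-swap N N _)) ⟩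
  ∑[ s ≤ N ] δ (n * s) i + ∑[ s ≤ N ] ∑[ x ≤ N ] ∑[ y ≤ N ] (⟦ y + x ≟ s ⟧ * δ (n * s) i)
    ≡⟨ ∑-+ N _ _ ⟨
  ∑[ s ≤ N ] (δ (n * s) i + ∑[ x ≤ N ] ∑[ y ≤ N ] (⟦ y + x ≟ s ⟧ * δ (n * s) i))
    ≡⟨ ∑-cong-≤ N (λ s 0<s s≤N → trans
         (cong (δ (n * s) i +_) (sym (trans (∑-*ʳ N (δ (n * s) i) _) (∑-cong N λ x → ∑-*ʳ N (δ (n * s) i) _))))
         (cong (_* δ (n * s) i) (∑-compositions s 0<s s≤N))) ⟩
  ∑[ s ≤ N ] (s * δ (n * s) i) ∎
  where
  open ≡-Reasoning
  collect : ∀ x y → 0 < x → ∑[ s ≤ N ] (⟦ y + x ≟ s ⟧ * δ (n * s) i) ≡ ⟦ n * x + n * y ≟ i ⟧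
  collect x y 0<x = trans
    (∑-δ N (y + x) (λ s → δ (n * s) i) (≤-trans 0<x (m≤n+m x y))
      λ N<y+x → ⟦⟧-> (≤-trans (≤-<-trans i≤N N<y+x) (m≤n*m (y + x) n)))
    (⟦⟧-≡ (trans (*-distribˡ-+ n y x) (+-comm (n * y) (n * x))))

-- The summands of the generating functions modulo 4

pairs : ℕ → ℕ → ℕ → ℕ
pairs n k N = ∑[ x ≤ N ] ∑[ y ≤ N ] (x * ⟦ n * x + k * y ≟ N ⟧)

A-⋆-tail : ∀ n k N .{{_ : NonZero n}} .{{_ : NonZero k}} → (A n ⋆ tail k) N ≡ pairs n k N
A-⋆-tail n k N = begin
  (A n ⋆ tail k) N
    ≡⟨ ⋆-cong-≤ N (λ j → A≡∑ n j) (λ j → tail≡∑ k j) ⟩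
  ((λ j → ∑[ x ≤ N ] (x * δ (n * x) j)) ⋆ (λ j → ∑[ y ≤ N ] δ (k * y) j)) N
    ≡⟨ ⋆-∑ˡ N (λ x j → x * δ (n * x) j) _ N ⟩
  ∑[ x ≤ N ] ((λ j → x * δ (n * x) j) ⋆ (λ j → ∑[ y ≤ N ] δ (k * y) j)) N
    ≡⟨ ∑-cong N (λ x → trans (⋆-scaleˡ x (δ (n * x)) _ N) (trans
         (cong (x *_) (trans (⋆-∑ʳ N (δ (n * x)) (λ y → δ (k * y)) N) (∑-cong N λ y → δ-⋆-δ (n * x) (k * y) N)))
         (sym (∑-* N x _)))) ⟩
  pairs n k N ∎
  where open ≡-Reasoning

A-⋆-∑tail : ∀ n k d c N .{{_ : NonZero n}} .{{_ : NonZero d}} →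
  (A n ⋆ (λ i → ∑[ b ≤ c ] tail (k + d * b) i)) N ≡ ∑[ b ≤ c ] pairs n (k + d * b) N
A-⋆-∑tail n k d c N = trans (⋆-∑ʳ c (A n) (λ b → tail (k + d * b)) N)
  (∑-cong-≤ c λ { b@(suc _) _ _ → A-⋆-tail n (k + d * b) N
    {{it}} {{>-nonZero (≤-trans (>-nonZero⁻¹ (d * b) {{m*n≢0 d b}}) (m≤n+m (d * b) k))}} })

A-⋆-1+2 : ∀ n u N .{{_ : NonZero n}} →
  (A n ⋆ (λ i → one i + 2 * u i)) N ≡ ∑[ x ≤ N ] (x * ⟦ n * x ≟ N ⟧) + 2 * (A n ⋆ u) N
A-⋆-1+2 n u N = trans (⋆-distribˡ (A n) one (λ i → 2 * u i) N)
  (cong₂ _+_ (trans (⋆-identityʳ (A n) N) (A≡∑ n N ≤-refl)) (⋆-scaleʳ 2 (A n) u N))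

sptbarTerm≈ : ∀ N n .{{_ : NonZero n}} →
  sptbarTerm N n ≈ ∑[ x ≤ N ] (x * ⟦ n * x ≟ N ⟧) + 2 * (∑[ b ≤ N ] pairs n (n + b) N) [mod 4 ]
-- The first exponent `suc n` is brought into the form `b + d` of `prodAP≈`, with `b = n` and
-- `d = 1`.
sptbarTerm≈ N n rewrite +-comm 1 n = begin
  shift n (geom n ⊗ geom n ⊗ num ⊗ den) N
    ≡⟨ shift-⋆ n _ N ⟩
  (δ n ⋆ (geom n ⊗ geom n ⊗ num ⊗ den)) N
    ≡⟨ ⋆-cong (λ _ → refl) regroup N ⟩
  (δ n ⋆ ((geom n ⋆ geom n) ⋆ (num ⋆ den))) N
    ≡⟨ ⋆-assoc (δ n) (geom n ⋆ geom n) (num ⋆ den) N ⟨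
  (A n ⋆ (num ⋆ den)) N
    ≈⟨ ⋆-≈ (λ _ → ≈-refl) (prodAP≈ n 1 N) N ⟩
  (A n ⋆ (λ i → one i + 2 * (∑[ b ≤ N ] tail (n + 1 * b) i))) N
    ≡⟨ A-⋆-1+2 n _ N ⟩
  ∑[ x ≤ N ] (x * ⟦ n * x ≟ N ⟧) + 2 * (A n ⋆ (λ i → ∑[ b ≤ N ] tail (n + 1 * b) i)) N
    ≡⟨ cong (λ z → ∑[ x ≤ N ] (x * ⟦ n * x ≟ N ⟧) + 2 * z) (trans (A-⋆-∑tail n n 1 N N)
         (∑-cong N λ b → cong (λ z → pairs n (n + z) N) (*-identityˡ b))) ⟩
  ∑[ x ≤ N ] (x * ⟦ n * x ≟ N ⟧) + 2 * (∑[ b ≤ N ] pairs n (n + b) N) ∎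
  where
  open ≈-Reasoning 4
  num = prodAP onePlus (n + 1) 1 N
  den = prodAP geom (n + 1) 1 N
  regroup : geom n ⊗ geom n ⊗ num ⊗ den ≗ (geom n ⋆ geom n) ⋆ (num ⋆ den)
  regroup = R.begin
    geom n ⊗ geom n ⊗ num ⊗ den      R.≈⟨ ⊗≗⋆ (geom n ⊗ geom n ⊗ num) den ⟩
    (geom n ⊗ geom n ⊗ num) ⋆ den    R.≈⟨ ⋆-cong (⊗≗⋆ (geom n ⊗ geom n) num) (λ _ → refl) ⟩
    (geom n ⊗ geom n) ⋆ num ⋆ den    R.≈⟨ ⋆-cong (⋆-cong (⊗≗⋆ (geom n) (geom n)) (λ _ → refl)) (λ _ → refl) ⟩
    geom n ⋆ geom n ⋆ num ⋆ den      R.≈⟨ ⋆-assoc (geom n ⋆ geom n) num den ⟩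
    (geom n ⋆ geom n) ⋆ (num ⋆ den)  R.∎
    where module R = ≗-Reasoning

-- The exponents fall into two progressions: `n + b` for `b ≤ n`, that is, from `n + 1` to `2 * n`,
-- and the even numbers above `2 * n`. `1+2-⋆` merges their contributions.
sptbarωTerm≈ : ∀ N n .{{_ : NonZero n}} →
  sptbarωTerm N n ≈ ∑[ x ≤ N ] (x * ⟦ n * x ≟ N ⟧)
    + 2 * (∑[ b ≤ n ] pairs n (n + b) N + ∑[ b ≤ N ] pairs n (2 * n + 2 * b) N) [mod 4 ]
sptbarωTerm≈ N n rewrite +-comm 1 n = begin
  shift n (geom n ⊗ geom n ⊗ P₁ ⊗ P₂ ⊗ G₁ ⊗ G₂) N
    ≡⟨ shift-⋆ n _ N ⟩
  (δ n ⋆ (geom n ⊗ geom n ⊗ P₁ ⊗ P₂ ⊗ G₁ ⊗ G₂)) N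
    ≡⟨ ⋆-cong (λ _ → refl) regroup N ⟩
  (δ n ⋆ ((geom n ⋆ geom n) ⋆ ((P₁ ⋆ G₁) ⋆ (P₂ ⋆ G₂)))) N
    ≡⟨ ⋆-assoc (δ n) (geom n ⋆ geom n) _ N ⟨
  (A n ⋆ ((P₁ ⋆ G₁) ⋆ (P₂ ⋆ G₂))) N
    ≈⟨ ⋆-≈ (λ _ → ≈-refl) (λ i → ≈-trans (⋆-≈ (prodAP≈ n 1 n) (prodAP≈ (2 * n) 2 N) i) (1+2-⋆ T₁ T₂ i)) N ⟩
  (A n ⋆ (λ i → one i + 2 * (T₁ i + T₂ i))) N
    ≡⟨ A-⋆-1+2 n _ N ⟩
  ∑[ x ≤ N ] (x * ⟦ n * x ≟ N ⟧) + 2 * (A n ⋆ (λ i → T₁ i + T₂ i)) N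
    ≡⟨ cong (λ z → ∑[ x ≤ N ] (x * ⟦ n * x ≟ N ⟧) + 2 * z) (trans (⋆-distribˡ (A n) T₁ T₂ N)
         (cong₂ _+_ (trans (A-⋆-∑tail n n 1 n N)
                           (∑-cong n λ b → cong (λ z → pairs n (n + z) N) (*-identityˡ b)))
                    (A-⋆-∑tail n (2 * n) 2 N N))) ⟩
  ∑[ x ≤ N ] (x * ⟦ n * x ≟ N ⟧)
    + 2 * (∑[ b ≤ n ] pairs n (n + b) N + ∑[ b ≤ N ] pairs n (2 * n + 2 * b) N) ∎
  where
  open ≈-Reasoning 4
  P₁ = prodAP onePlus (n + 1) 1 n
  P₂ = prodAP onePlus (2 * n + 2) 2 N
  G₁ = prodAP geom (n + 1) 1 n
  G₂ = prodAP geom (2 * n + 2) 2 N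
  T₁ T₂ : Series
  T₁ i = ∑[ b ≤ n ] tail (n + 1 * b) i
  T₂ i = ∑[ b ≤ N ] tail (2 * n + 2 * b) i
  G² = geom n ⊗ geom n
  regroup : geom n ⊗ geom n ⊗ P₁ ⊗ P₂ ⊗ G₁ ⊗ G₂ ≗ (geom n ⋆ geom n) ⋆ ((P₁ ⋆ G₁) ⋆ (P₂ ⋆ G₂))
  regroup = R.begin
    G² ⊗ P₁ ⊗ P₂ ⊗ G₁ ⊗ G₂          R.≈⟨ ⊗≗⋆ (G² ⊗ P₁ ⊗ P₂ ⊗ G₁) G₂ ⟩
    (G² ⊗ P₁ ⊗ P₂ ⊗ G₁) ⋆ G₂        R.≈⟨ ⋆-congˡ (⊗≗⋆ (G² ⊗ P₁ ⊗ P₂) G₁) ⟩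
    (G² ⊗ P₁ ⊗ P₂) ⋆ G₁ ⋆ G₂        R.≈⟨ ⋆-congˡ (⋆-congˡ (⊗≗⋆ (G² ⊗ P₁) P₂)) ⟩
    (G² ⊗ P₁) ⋆ P₂ ⋆ G₁ ⋆ G₂        R.≈⟨ ⋆-congˡ (⋆-congˡ (⋆-congˡ (⊗≗⋆ G² P₁))) ⟩
    G² ⋆ P₁ ⋆ P₂ ⋆ G₁ ⋆ G₂          R.≈⟨ ⋆-congˡ (⋆-congˡ (⋆-congˡ (⋆-congˡ (⊗≗⋆ (geom n) (geom n))))) ⟩
    S ⋆ P₁ ⋆ P₂ ⋆ G₁ ⋆ G₂           R.≈⟨ ⋆-assoc (S ⋆ P₁ ⋆ P₂) G₁ G₂ ⟩
    S ⋆ P₁ ⋆ P₂ ⋆ (G₁ ⋆ G₂)         R.≈⟨ ⋆-congˡ (⋆-assoc S P₁ P₂) ⟩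
    S ⋆ (P₁ ⋆ P₂) ⋆ (G₁ ⋆ G₂)       R.≈⟨ ⋆-assoc S (P₁ ⋆ P₂) (G₁ ⋆ G₂) ⟩
    S ⋆ ((P₁ ⋆ P₂) ⋆ (G₁ ⋆ G₂))     R.≈⟨ ⋆-cong (λ _ → refl) (interchange P₁ P₂ G₁ G₂) ⟩
    S ⋆ ((P₁ ⋆ G₁) ⋆ (P₂ ⋆ G₂))     R.∎
    where
    module R = ≗-Reasoning
    S = geom n ⋆ geom n
    ⋆-congˡ : ∀ {f f′ g} → f ≗ f′ → f ⋆ g ≗ f′ ⋆ g
    ⋆-congˡ f≗f′ = ⋆-cong f≗f′ (λ _ → refl)

pairs-> : ∀ n k N → N < k → pairs n k N ≡ 0
pairs-> n k N N<k = ∑-0 N λ x _ _ → ∑-0 N λ { y@(suc _) _ _ →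
  trans (cong (x *_) (⟦⟧-> (≤-trans N<k (≤-trans (m≤m*n k y) (m≤n+m (k * y) (n * x)))))) (*-zeroʳ x) }

-- The indices n + b with b > n are 2n + b with b ≥ 1, and modulo 2 the weight b removes the
-- even ones among them.
ω-range : ∀ N n → ∑[ b ≤ n ] pairs n (n + b) N + ∑[ b ≤ N ] pairs n (2 * n + 2 * b) N ≈
                  ∑[ b ≤ N ] pairs n (n + b) N + ∑[ b ≤ N ] (b * pairs n (2 * n + b) N) [mod 2 ]
ω-range N n = begin
  u + ∑[ b ≤ N ] pairs n (2 * n + 2 * b) N
    ≈⟨ ≈-+ (≈-refl {u}) (∑-even N (λ b → pairs n (2 * n + b) N)
         (λ b N<b → pairs-> n (2 * n + b) N (≤-trans N<b (m≤n+m b (2 * n))))) ⟨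
  u + ∑[ b ≤ N ] ((1 + b) * pairs n (2 * n + b) N)
    ≡⟨ cong (u +_) (∑-+ N _ _) ⟩
  u + (∑[ b ≤ N ] pairs n (2 * n + b) N + v)
    ≡⟨ +-assoc u _ v ⟨
  u + ∑[ b ≤ N ] pairs n (2 * n + b) N + v
    ≡⟨ cong (λ z → u + z + v) (∑-cong N λ b → cong (λ z → pairs n z N) (lemma n b)) ⟩
  u + ∑[ b ≤ N ] pairs n (n + (n + b)) N + v
    ≡⟨ cong (_+ v) (∑-split n N (λ b → pairs n (n + b) N)) ⟨
  ∑[ b ≤ n + N ] pairs n (n + b) N + v
    ≡⟨ cong (_+ v) (∑-extend (m≤n+m N n) λ b N<b → pairs-> n (n + b) N (≤-trans N<b (m≤n+m b n))) ⟩
  ∑[ b ≤ N ] pairs n (n + b) N + v ∎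
  where
  open ≈-Reasoning 2
  u = ∑[ b ≤ n ] pairs n (n + b) N
  v = ∑[ b ≤ N ] (b * pairs n (2 * n + b) N)
  lemma : ∀ n b → 2 * n + b ≡ n + (n + b)
  lemma = solve-∀

-- Reduction of both functions modulo 4 and conclusion

sptbar≈ : ∀ N → sptbar N ≈ σ N + 2 * (r 1 N + r 2 N) [mod 4 ]
sptbar≈ N = begin
  sptbar N
    ≡⟨ Σℕ-upTo N (sptbarTerm N) ⟩
  ∑ N (sptbarTerm N)
    ≈⟨ ∑-≈ N (λ { a@(suc _) _ _ → sptbarTerm≈ N a }) ⟩
  ∑[ a ≤ N ] (∑[ x ≤ N ] (x * ⟦ a * x ≟ N ⟧) + 2 * (∑[ b ≤ N ] pairs a (a + b) N))
    ≡⟨ trans (∑-+ N _ _) (cong (σ N +_) (∑-* N 2 _)) ⟩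
  σ N + 2 * crossSum N
    ≈⟨ ≈-+ (≈-refl {σ N}) (≈-scale 2 (crossSum≈r N)) ⟩
  σ N + 2 * (r 1 N + r 2 N) ∎
  where open ≈-Reasoning 4

-- `ω-range` holds only modulo 2, which suffices under the factor 2. It splits the count into the
-- one for `sptbar` and the correction `oddCrossSum`.
sptbarω≈ : ∀ N → 0 < N → sptbarω N ≈ σ N + 2 * (r 1 N + r 2 N + (s 4 N + s 8 N)) [mod 4 ]
sptbarω≈ N 0<N = begin
  sptbarω N
    ≡⟨ Σℕ-upTo N (sptbarωTerm N) ⟩
  ∑ N (sptbarωTerm N)
    ≈⟨ ∑-≈ N (λ { a@(suc _) _ _ → ≈-trans (sptbarωTerm≈ N a) 
         (≈-+ (≈-refl {∑[ x ≤ N ] (x * ⟦ a * x ≟ N ⟧)}) (≈-scale 2 (ω-range N a))) }) ⟩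
  ∑[ a ≤ N ] (∑[ x ≤ N ] (x * ⟦ a * x ≟ N ⟧)
               + 2 * (∑[ b ≤ N ] pairs a (a + b) N + ∑[ b ≤ N ] (b * pairs a (2 * a + b) N)))
    ≡⟨ trans (∑-+ N _ _) (cong (σ N +_) (trans (∑-* N 2 _) (cong (2 *_) (∑-+ N _ _)))) ⟩
  σ N + 2 * (crossSum N + ∑[ a ≤ N ] ∑[ b ≤ N ] (b * pairs a (2 * a + b) N))
    ≡⟨ cong (λ z → σ N + 2 * (crossSum N + z)) (∑-cong N λ a → ∑-cong N λ b →
         sym (trans (∑-cong N λ x → ∑-* N b _) (∑-* N b _))) ⟩
  σ N + 2 * (crossSum N + oddCrossSum N)
    ≈⟨ ≈-+ (≈-refl {σ N}) (≈-scale 2 (≈-+ (crossSum≈r N) (oddCrossSum≈s N 0<N))) ⟩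
  σ N + 2 * (r 1 N + r 2 N + (s 4 N + s 8 N)) ∎
  where open ≈-Reasoning 4

r₁+r₂-periodic : Periodic 4 (λ n → r 1 n + r 2 n)
r₁+r₂-periodic = periodic-+ (r-periodic 1 (from-yes (anisotropicMod7? 1)))
                            (r-periodic 2 (from-yes (anisotropicMod7? 2)))

s₄+s₈-periodic : Periodic 4 (λ n → s 4 n + s 8 n)
s₄+s₈-periodic = periodic-+ (s-periodic 4 (from-no (7 ∣? 4))) (s-periodic 8 (from-no (7 ∣? 8)))

theorem1p7 : (n : ℕ) → 1 ≤ n →
    (sptbar (7 * n) % 4 ≡ atDiv7 sptbar n % 4) ×
    (sptbarω (7 * n) % 4 ≡ atDiv7 sptbarω n % 4)
theorem1p7 n 1≤n =
  ≈⇒% (at-7* (periodic-resp (λ N _ → sptbar≈ N) (periodic-+ σ-periodic (periodic-* 2 r₁+r₂-periodic))) n 1≤n) ,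
  ≈⇒% (at-7* (periodic-resp sptbarω≈ (periodic-+ σ-periodic
               (periodic-* 2 (periodic-+ r₁+r₂-periodic s₄+s₈-periodic)))) n 1≤n)
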